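{- For every nonnegative integer $\ell$, every nonnegative integer $n$ and every complex number $x$, $$\sum_{k=0}^n (q^{ -3n};q^3)_k \left[\begin{matrix} x,\ q^{2-\ell}/x\\ q,\ -q,\ q^{3/2},\ -q^{3/2-\ell},\ q^{ -1-3n}\end{matrix}\middle| q\right]_k q^k = \left[\begin{matrix} xq^{ -1},\ -xq^{ -1/2}\\ x^2q^{ -1},\ -q^{ -1/2}\end{matrix}\middle|q\right]_\ell \sum_{i=0}^{\ell}(-1)^i q^{(\ell-\frac12)i}\,\frac{1-x^2q^{2i-2}}{1-x^2q^{ -2}}\left[\begin{matrix} q^{ -\ell},\ x,\ x^2q^{ -2}\\ q,\ xq^{ -1},\ x^2q^{\ell-1}\end{matrix}\middle|q\right]_i\left[\begin{matrix} q^{2+i}x,\ q^{4-i}/x\\ q^2,\ q^4\end{matrix}\middle|q^3\right]_n.$$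
   Context: $q$ is a complex number with a fixed square root $q^{1/2}$, and $q^{r/2}$ means $(q^{1/2})^r$. For a complex number $a$, a base $p$ and a nonnegative integer $m$, $(a;p)_m=\prod_{j=0}^{m-1}(1-ap^j)$ with $(a;p)_0=1$. The bracket notation means $\left[\begin{matrix} a_1,\dots,a_r\\ b_1,\dots,b_s\end{matrix}\middle|p\right]_m=\frac{(a_1;p)_m\cdots(a_r;p)_m}{(b_1;p)_m\cdots(b_s;p)_m}$ (used with $p=q$ and $p=q^3$). The identity is understood for values of the parameters for which no denominator vanishes. -}

module Defs where

open import Level using (Level; _⊔_) renaming (suc to lsuc)
open import Data.Nat using (ℕ; zero; suc)
open import Data.Integer using (ℤ; +_; -[1+_])
open import Relation.Nullary using (¬_)
open import Algebra.Bundles using (CommutativeRing)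

ringFromℕ : ∀ {c ℓ} (R : CommutativeRing c ℓ) → ℕ → CommutativeRing.Carrier R
ringFromℕ R zero    = CommutativeRing.0# R
ringFromℕ R (suc n) = CommutativeRing._+_ R (CommutativeRing.1# R) (ringFromℕ R n)

-- A field of characteristic zero, presented as a commutative ring with a
-- total inverse operation that is a genuine inverse on nonzero elements
-- (the value of 0⁻¹ is unconstrained and is never used under the
-- hypotheses of the theorem).  The complex numbers are such a field.
record CharZeroField (c ℓ : Level) : Set (lsuc (c ⊔ ℓ)) where
  field
    commutativeRing : CommutativeRing c ℓ
  open CommutativeRing commutativeRing public
  field
    _⁻¹       : Carrier → Carrier
    ⁻¹-cong   : ∀ {a b} → a ≈ b → a ⁻¹ ≈ b ⁻¹
    ⁻¹-inverse : ∀ a → ¬ (a ≈ 0#) → a * (a ⁻¹) ≈ 1#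

    charZero  : ∀ n → ¬ (ringFromℕ commutativeRing (suc n) ≈ 0#)

module Basic {c ℓ : Level} (F : CharZeroField c ℓ) where
  open CharZeroField F

  pow : Carrier → ℕ → Carrier
  pow a zero    = 1#
  pow a (suc m) = a * pow a m

  zpow : Carrier → ℤ → Carrier
  zpow a (+ m)      = pow a m
  zpow a -[1+ m ]   = pow (a ⁻¹) (suc m)

  poch : Carrier → Carrier → ℕ → Carrier
  poch a p zero    = 1#
  poch a p (suc m) = poch a p m * (1# - a * pow p m)

  sumTo : ℕ → (ℕ → Carrier) → Carrier
  sumTo zero    f = f 0
  sumTo (suc n) f = sumTo n f + f (suc n)

{-# OPTIONS --safe #-}
module Submission where

-- Newton interpolation of (q²u, q⁴/u; q³)_n in the products (u, q²/u; q)_k has coefficients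
-- V n k given by a two-term recursion; a contiguity relation between V n (k + 1) and V n k
-- turns them into the q-shifted factorials of the left-hand side (the case ℓ = 0).
-- Applying this with u = x qⁱ on the right-hand side, the claim reduces for each k to a
-- terminating very-well-poised ₆φ₅ sum expanding (x, q^{2-ℓ}/x; q)_k in the products
-- (x qⁱ, q^{2-i}/x; q)_k, which follows by induction on ℓ from a relation between ℓ + 1 at x
-- and ℓ at x and x q.  Dividing by (-q^{3/2}; q)_k is never allowed, since this product may
-- vanish under the hypotheses; hence both steps are carried out free of that denominator.

-- Working without the division is possible because the quotient of (-q^(3/2); q)_k by the factor
-- (-q^(3/2-ℓ); q)_k of the left-hand side is a polynomial in q^k up to a constant: (-q^(3/2); q)_k
-- (-q^(-1/2); q)_ℓ equals (-q^(3/2-ℓ); q)_k times ∏_{j<ℓ} (q^k + q^(j-1/2)). The ₆φ₅ sum is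
-- therefore stated with this product `P` as an extra factor next to (x, q^(2-ℓ)/x; q)_k. Raising ℓ
-- by 1 adds one factor to `P`, and the resulting three-term relation of the products is matched by
-- one of the coefficients, a well-poised deformation of the q-Pascal rule. The natural variable is
-- X = x/q, since the very-well-poised series has parameter X² = x²/q². Inverses and the square root
-- enter the polynomial identities only through q p = 1, q t² = 1 and X Y = 1.

open import Defs
open import Level using (Level; _⊔_)
open import Data.Nat using (ℕ; _≤_)
open import Data.Integer using (ℤ; +_) renaming (_+_ to _+ℤ_; _*_ to _*ℤ_; _-_ to _-ℤ_; -_ to -ℤ_)
open import Relation.Nullary using (¬_; yes; no)
open import Data.Nat.Base as ℕ using (zero; suc; _<_; z≤n; s≤s)
import Data.Nat.Properties as ℕₚ
open import Data.Integer.Base as ℤ using (-[1+_]; _⊖_; _◃_)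
import Data.Integer.Properties as ℤₚ
import Data.Sign.Base as Sign
open import Data.Sum.Base using (inj₁; inj₂)
open import Data.Maybe.Base using (map)
open import Relation.Nullary.Decidable using (dec⇒maybe)
open import Relation.Binary.PropositionalEquality as ≡ using (_≡_)
open import Algebra.Bundles using (CommutativeRing)
open import Algebra.Solver.Ring.AlmostCommutativeRing using (fromCommutativeRing; _-Raw-AlmostCommutative⟶_)
import Algebra.Solver.Ring

-- Coefficients in ℤ, where equality is decidable, let the ring solver cancel terms in an arbitrary commutative ring.
module IntegerCoefficients {c ℓ} (R : CommutativeRing c ℓ) where
  open CommutativeRing R
  open import Algebra.Properties.Semiring.Mult.TCOptimised semiring using (_×_; ×-homo-+; ×1-homo-*; 1+×)
  open import Algebra.Properties.Ring ring
  open import Algebra.Properties.AbelianGroup +-abelianGroup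
  open import Relation.Binary.Reasoning.Setoid setoid

  fromℤ : ℤ → Carrier
  fromℤ (+ n)    = n × 1#
  fromℤ -[1+ n ] = - (suc n × 1#)

  fromℤ-⊖ : ∀ m n → fromℤ (m ⊖ n) ≈ m × 1# - n × 1#
  fromℤ-⊖ m       zero    = sym (trans (+-congˡ ε⁻¹≈ε) (+-identityʳ _))
  fromℤ-⊖ zero    (suc n) = sym (+-identityˡ _)
  fromℤ-⊖ (suc m) (suc n) = begin
    fromℤ (suc m ⊖ suc n)                     ≡⟨ ≡.cong fromℤ (ℤₚ.[1+m]⊖[1+n]≡m⊖n m n) ⟩
    fromℤ (m ⊖ n)                             ≈⟨ fromℤ-⊖ m n ⟩
    m × 1# - n × 1#                           ≈⟨ +-congʳ (trans (+-congʳ (-‿inverseʳ 1#)) (+-identityˡ _)) ⟨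
    (1# - 1# + m × 1#) - n × 1#               ≈⟨ +-congʳ (trans (+-assoc _ _ _) (trans (+-congˡ (+-comm _ _)) (sym (+-assoc _ _ _)))) ⟩
    (1# + m × 1# - 1#) - n × 1#               ≈⟨ +-assoc _ _ _ ⟩
    1# + m × 1# + (- 1# - n × 1#)             ≈⟨ +-cong (sym (1+× m 1#)) (trans (⁻¹-∙-comm _ _) (-‿cong (sym (1+× n 1#)))) ⟩
    suc m × 1# - suc n × 1#                   ∎

  fromℤ-+ : ∀ i j → fromℤ (i ℤ.+ j) ≈ fromℤ i + fromℤ j
  fromℤ-+ (+ m)    (+ n)    = ×-homo-+ 1# m n
  fromℤ-+ (+ m)    -[1+ n ] = fromℤ-⊖ m (suc n)
  fromℤ-+ -[1+ m ] (+ n)    = trans (fromℤ-⊖ n (suc m)) (+-comm _ _)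
  fromℤ-+ -[1+ m ] -[1+ n ] = begin
    - (suc (suc (m ℕ.+ n)) × 1#)      ≡⟨ ≡.cong (λ k → - (suc k × 1#)) (≡.sym (ℕₚ.+-suc m n)) ⟩
    - ((suc m ℕ.+ suc n) × 1#)        ≈⟨ -‿cong (×-homo-+ 1# (suc m) (suc n)) ⟩
    - (suc m × 1# + suc n × 1#)       ≈⟨ ⁻¹-∙-comm _ _ ⟨
    - (suc m × 1#) - suc n × 1#       ∎

  fromℤ-neg : ∀ i → fromℤ (ℤ.- i) ≈ - fromℤ i
  fromℤ-neg (+ zero)  = sym ε⁻¹≈ε
  fromℤ-neg (+ suc n) = refl
  fromℤ-neg -[1+ n ]  = sym (⁻¹-involutive _)

  fromℤ-pos◃ : ∀ n → fromℤ (Sign.+ ◃ n) ≈ n × 1#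
  fromℤ-pos◃ zero    = refl
  fromℤ-pos◃ (suc n) = refl

  fromℤ-neg◃ : ∀ n → fromℤ (Sign.- ◃ n) ≈ - (n × 1#)
  fromℤ-neg◃ zero    = sym ε⁻¹≈ε
  fromℤ-neg◃ (suc n) = refl

  fromℤ-* : ∀ i j → fromℤ (i ℤ.* j) ≈ fromℤ i * fromℤ j
  fromℤ-* (+ m)    (+ n)    = trans (fromℤ-pos◃ (m ℕ.* n)) (×1-homo-* m n)
  fromℤ-* (+ m)    -[1+ n ] = trans (fromℤ-neg◃ (m ℕ.* suc n)) (trans (-‿cong (×1-homo-* m (suc n))) (-‿distribʳ-* _ _))
  fromℤ-* -[1+ m ] (+ n)    = trans (fromℤ-neg◃ (suc m ℕ.* n)) (trans (-‿cong (×1-homo-* (suc m) n)) (-‿distribˡ-* _ _))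
  fromℤ-* -[1+ m ] -[1+ n ] = trans (fromℤ-pos◃ (suc m ℕ.* suc n)) (trans (×1-homo-* (suc m) (suc n))
    (trans (sym (⁻¹-involutive _)) (trans (-‿cong (-‿distribʳ-* _ _)) (-‿distribˡ-* _ _))))

  fromℤ-homomorphism : ℤ.+-*-rawRing -Raw-AlmostCommutative⟶ fromCommutativeRing R
  fromℤ-homomorphism = record
    { ⟦_⟧ = fromℤ ; +-homo = fromℤ-+ ; *-homo = fromℤ-* ; -‿homo = fromℤ-neg
    ; 0-homo = refl ; 1-homo = refl }

  open Algebra.Solver.Ring ℤ.+-*-rawRing (fromCommutativeRing R) fromℤ-homomorphism
    (λ i j → map (λ eq → reflexive (≡.cong fromℤ eq)) (dec⇒maybe (i ℤₚ.≟ j))) public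
    using (solve; _:=_; con; _:+_; _:*_; _:-_; :-_; _:^_; Polynomial)

  :1 : ∀ {n} → Polynomial n
  :1 = con (+ 1)

-- Field arithmetic, q-shifted factorials and finite sums.

module FieldProperties {c ℓ} (F : CharZeroField c ℓ) where
  open CharZeroField F
  open Basic F
  open IntegerCoefficients commutativeRing
  open import Relation.Binary.Reasoning.Setoid setoid

  1≉0 : ¬ (1# ≈ 0#)
  1≉0 1≈0 = charZero 0 (trans (+-identityʳ 1#) 1≈0)

  *-cancelˡ : ∀ {a b c} → ¬ (a ≈ 0#) → a * b ≈ a * c → b ≈ c
  *-cancelˡ {a} {b} {c} a≉0 ab≈ac = trans (sym (strip b)) (trans (*-congˡ ab≈ac) (strip c))
    where
    strip : ∀ d → a ⁻¹ * (a * d) ≈ d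
    strip d = trans (sym (*-assoc _ _ _))
      (trans (*-congʳ (trans (*-comm _ _) (⁻¹-inverse a a≉0))) (*-identityˡ d))

  *-nonzero : ∀ {a b} → ¬ (a ≈ 0#) → ¬ (b ≈ 0#) → ¬ (a * b ≈ 0#)
  *-nonzero a≉0 b≉0 ab≈0 = b≉0 (*-cancelˡ a≉0 (trans ab≈0 (sym (zeroʳ _))))

  nonzeroˡ : ∀ {a b} → ¬ (a * b ≈ 0#) → ¬ (a ≈ 0#)
  nonzeroˡ ab≉0 a≈0 = ab≉0 (trans (*-congʳ a≈0) (zeroˡ _))

  nonzeroʳ : ∀ {a b} → ¬ (a * b ≈ 0#) → ¬ (b ≈ 0#)
  nonzeroʳ ab≉0 b≈0 = ab≉0 (trans (*-congˡ b≈0) (zeroʳ _))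

  nonzero-resp : ∀ {a b} → a ≈ b → ¬ (a ≈ 0#) → ¬ (b ≈ 0#)
  nonzero-resp a≈b a≉0 b≈0 = a≉0 (trans a≈b b≈0)

  -- A nonzero product has nonzero factors, so one hypothesis covers both inverses. This expresses
  -- the inverse of a shorter product through that of a longer one, which gives different summands a
  -- common inverse.
  ⁻¹-factorˡ : ∀ {a b c} → ¬ (c ≈ 0#) → c ≈ a * b → a ⁻¹ ≈ b * c ⁻¹
  ⁻¹-factorˡ {a} {b} {c} c≉0 c≈ab = *-cancelˡ (nonzeroˡ ab≉0) (begin
    a * a ⁻¹        ≈⟨ ⁻¹-inverse a (nonzeroˡ ab≉0) ⟩
    1#              ≈⟨ ⁻¹-inverse c c≉0 ⟨
    c * c ⁻¹        ≈⟨ *-congʳ c≈ab ⟩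
    a * b * c ⁻¹    ≈⟨ *-assoc _ _ _ ⟩
    a * (b * c ⁻¹)  ∎)
    where ab≉0 = nonzero-resp c≈ab c≉0

  -- Lets a relation such as q t² = 1 enter a solver identity: the solver proves an identity of
  -- polynomials with explicit multiples of 1 - w added, and these are then discarded.
  drop-term : ∀ a b {w} → w ≈ 1# → a + b * (1# - w) ≈ a
  drop-term a b {w} w≈1 = begin
    a + b * (1# - w)   ≈⟨ +-congˡ (*-congˡ (+-congˡ (-‿cong w≈1))) ⟩
    a + b * (1# - 1#)  ≈⟨ solve 2 (λ a b → a :+ b :* (:1 :- :1) := a) refl a b ⟩
    a                  ∎

  pow-cong : ∀ {a b} → a ≈ b → ∀ m → pow a m ≈ pow b m
  pow-cong a≈b zero    = refl
  pow-cong a≈b (suc m) = *-cong a≈b (pow-cong a≈b m)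

  pow-+ : ∀ a m n → pow a (m ℕ.+ n) ≈ pow a m * pow a n
  pow-+ a zero    n = sym (*-identityˡ _)
  pow-+ a (suc m) n = trans (*-congˡ (pow-+ a m n)) (sym (*-assoc _ _ _))

  pow-* : ∀ a b m → pow (a * b) m ≈ pow a m * pow b m
  pow-* a b zero    = sym (*-identityˡ 1#)
  pow-* a b (suc m) = trans (*-congˡ (pow-* a b m))
    (solve 4 (λ a b c d → a :* b :* (c :* d) := a :* c :* (b :* d)) refl a b (pow a m) (pow b m))

  pow-1 : ∀ m → pow 1# m ≈ 1#
  pow-1 zero    = refl
  pow-1 (suc m) = trans (*-identityˡ _) (pow-1 m)

  pow-inverse : ∀ {a b} → a * b ≈ 1# → ∀ m → pow a m * pow b m ≈ 1#
  pow-inverse {a} {b} ab≈1 m = trans (sym (pow-* a b m)) (trans (pow-cong ab≈1 m) (pow-1 m))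

  pow-pow : ∀ a m n → pow a (m ℕ.* n) ≈ pow (pow a m) n
  pow-pow a zero    n = sym (pow-1 n)
  pow-pow a (suc m) n = trans (pow-+ a n (m ℕ.* n))
    (trans (*-congˡ (pow-pow a m n)) (sym (pow-* a (pow a m) n)))

  poch-cong : ∀ {a b p r} → a ≈ b → p ≈ r → ∀ m → poch a p m ≈ poch b r m
  poch-cong a≈b p≈r zero    = refl
  poch-cong a≈b p≈r (suc m) =
    *-cong (poch-cong a≈b p≈r m) (+-congˡ (-‿cong (*-cong a≈b (pow-cong p≈r m))))

  poch-congˡ : ∀ {a b} p m → a ≈ b → poch a p m ≈ poch b p m
  poch-congˡ p m a≈b = poch-cong a≈b refl m

  poch-+ : ∀ a p m n → poch a p (m ℕ.+ n) ≈ poch a p m * poch (a * pow p m) p n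
  poch-+ a p m zero    rewrite ℕₚ.+-identityʳ m = sym (*-identityʳ _)
  poch-+ a p m (suc n) rewrite ℕₚ.+-suc m n = begin
    poch a p (m ℕ.+ n) * (1# - a * pow p (m ℕ.+ n))
      ≈⟨ *-cong (poch-+ a p m n) (+-congˡ (-‿cong (trans (*-congˡ (pow-+ p m n)) (sym (*-assoc _ _ _))))) ⟩
    poch a p m * poch (a * pow p m) p n * (1# - a * pow p m * pow p n)
      ≈⟨ *-assoc _ _ _ ⟩
    poch a p m * (poch (a * pow p m) p n * (1# - a * pow p m * pow p n)) ∎

  poch-suc : ∀ a p m → poch a p (suc m) ≈ (1# - a) * poch (p * a) p m
  poch-suc a p m = begin
    poch a p (suc m)                       ≈⟨ poch-+ a p 1 m ⟩
    1# * (1# - a * 1#) * poch (a * (p * 1#)) p m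
      ≈⟨ *-cong (solve 1 (λ a → :1 :* (:1 :- a :* :1) := :1 :- a) refl a)
           (poch-congˡ p m (solve 2 (λ a p → a :* (p :* :1) := p :* a) refl a p)) ⟩
    (1# - a) * poch (p * a) p m            ∎

  poch-nonzero : ∀ a p m → (∀ j → j < m → ¬ (1# - a * pow p j ≈ 0#)) → ¬ (poch a p m ≈ 0#)
  poch-nonzero a p zero    _  = 1≉0
  poch-nonzero a p (suc m) nz =
    *-nonzero (poch-nonzero a p m (λ j j<m → nz j (ℕₚ.m<n⇒m<1+n j<m))) (nz m ℕₚ.≤-refl)

  poch-factor-nonzero : ∀ a p m → ¬ (poch a p m ≈ 0#) → ∀ j → j < m → ¬ (1# - a * pow p j ≈ 0#)
  poch-factor-nonzero a p (suc m) nz j (s≤s j≤m) with ℕₚ.m≤n⇒m<n∨m≡n j≤m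
  ... | inj₁ j<m    = poch-factor-nonzero a p m (nonzeroˡ nz) j j<m
  ... | inj₂ ≡.refl = nonzeroʳ nz

  sumTo-cong : ∀ n {f g : ℕ → Carrier} → (∀ k → k ≤ n → f k ≈ g k) → sumTo n f ≈ sumTo n g
  sumTo-cong zero    f≈g = f≈g 0 z≤n
  sumTo-cong (suc n) f≈g =
    +-cong (sumTo-cong n (λ k k≤n → f≈g k (ℕₚ.m≤n⇒m≤1+n k≤n))) (f≈g (suc n) ℕₚ.≤-refl)

  *-distribˡ-sumTo : ∀ n c (f : ℕ → Carrier) → c * sumTo n f ≈ sumTo n (λ k → c * f k)
  *-distribˡ-sumTo zero    c f = refl
  *-distribˡ-sumTo (suc n) c f = trans (distribˡ _ _ _) (+-congʳ (*-distribˡ-sumTo n c f))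

  sumTo-+ : ∀ n (f g : ℕ → Carrier) → sumTo n (λ k → f k + g k) ≈ sumTo n f + sumTo n g
  sumTo-+ zero    f g = refl
  sumTo-+ (suc n) f g = trans (+-congʳ (sumTo-+ n f g))
    (solve 4 (λ a b c d → a :+ b :+ (c :+ d) := a :+ c :+ (b :+ d)) refl
      (sumTo n f) (sumTo n g) (f (suc n)) (g (suc n)))

  sumTo-swap : ∀ m n (f : ℕ → ℕ → Carrier) →
    sumTo m (λ i → sumTo n (f i)) ≈ sumTo n (λ k → sumTo m (λ i → f i k))
  sumTo-swap zero    n f = refl
  sumTo-swap (suc m) n f = trans (+-congʳ (sumTo-swap m n f)) (sym (sumTo-+ n _ _))

  -- The shape common to both expansions: each new term splits into a contribution `a` that keeps
  -- its index and a contribution `b` that comes from the index below. The two sums have equal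
  -- length because `a` vanishes just past the end.
  sumTo-pascal : ∀ n {f a b : ℕ → Carrier} → f 0 ≈ a 0 →
    (∀ k → k ≤ n → f (suc k) ≈ a (suc k) + b k) → a (suc n) ≈ 0# →
    sumTo (suc n) f ≈ sumTo n a + sumTo n b
  sumTo-pascal n {f} {a} {b} f₀ f₊ a₊≈0 = begin
    sumTo (suc n) f                      ≈⟨ split n f₊ ⟩
    sumTo n a + a (suc n) + sumTo n b    ≈⟨ +-congʳ (trans (+-congˡ a₊≈0) (+-identityʳ _)) ⟩
    sumTo n a + sumTo n b                ∎
    where
    split : ∀ m → (∀ k → k ≤ m → f (suc k) ≈ a (suc k) + b k) →
      sumTo (suc m) f ≈ sumTo (suc m) a + sumTo m b
    split zero    f₊ = trans (+-cong f₀ (f₊ 0 z≤n)) (sym (+-assoc _ _ _))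
    split (suc m) f₊ = trans
      (+-cong (split m (λ k k≤m → f₊ k (ℕₚ.m≤n⇒m≤1+n k≤m))) (f₊ (suc m) ℕₚ.≤-refl))
      (solve 4 (λ a b c d → a :+ b :+ (c :+ d) := a :+ c :+ (b :+ d)) refl
        (sumTo (suc m) a) (sumTo m b) (a (suc (suc m))) (b (suc m)))

-- p stands for 1/q and t for q^{-1/2}.
record SquareRootBase {o ℓ} (F : CharZeroField o ℓ) : Set (o ⊔ ℓ) where
  open CharZeroField F
  field
    q p t : Carrier
    qp≈1  : q * p ≈ 1#
    qtt≈1 : q * (t * t) ≈ 1#

-- Newton expansion of the base-q³ products and closed form of its coefficients.

module CubicExpansion {o ℓ} (F : CharZeroField o ℓ) (base : SquareRootBase F) where
  open CharZeroField F
  open SquareRootBase base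
  open Basic F
  open FieldProperties F
  open IntegerCoefficients commutativeRing
  open import Relation.Binary.Reasoning.Setoid setoid

  qᵏpᵏ≈1 : ∀ k → pow q k * pow p k ≈ 1#
  qᵏpᵏ≈1 = pow-inverse qp≈1

  -- This is q^(3n+2): passing from n to n + 1 multiplies the cubic product by (1 - ν u)(1 - q² ν
  -- v).
  ν : ℕ → Carrier
  ν n = q * q * pow (pow q 3) n

  ρ : ℕ → ℕ → Carrier
  ρ n k = ν n * pow p k

  ρ-suc : ∀ n k → ρ n k ≈ q * ρ n (suc k)
  ρ-suc n k = begin
    ν n * pow p k              ≈⟨ *-identityˡ _ ⟨
    1# * (ν n * pow p k)       ≈⟨ *-congʳ qp≈1 ⟨
    q * p * (ν n * pow p k)    ≈⟨ solve 4 (λ q p n k → q :* p :* (n :* k) := q :* (n :* (p :* k))) refl q p (ν n) (pow p k) ⟩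
    q * (ν n * (p * pow p k))  ∎

  ρ*qᵏ : ∀ n k → ρ n k * pow q k ≈ ν n
  ρ*qᵏ n k = begin
    ν n * pow p k * pow q k    ≈⟨ solve 3 (λ n k l → n :* k :* l := n :* (l :* k)) refl (ν n) (pow p k) (pow q k) ⟩
    ν n * (pow q k * pow p k)  ≈⟨ *-congˡ (qᵏpᵏ≈1 k) ⟩
    ν n * 1#                   ≈⟨ *-identityʳ _ ⟩
    ν n                        ∎

  -- The value of (1 - ν u)(1 - q² ν v) at the interpolation node u = q^(-k), v = q^k. The
  -- difference from this value is a multiple of (1 - u q^k)(1 - q² v q^k), and comparing the
  -- coefficients of u gives the multiplier `ρ n k`; hence the recursion for `V`.
  α : ℕ → ℕ → Carrier
  α n k = (1# - ρ n k) * (1# - q * q * ν n * pow q k)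

  V : ℕ → ℕ → Carrier
  V zero    zero    = 1#
  V zero    (suc k) = 0#
  V (suc n) zero    = α n 0 * V n 0
  V (suc n) (suc k) = α n (suc k) * V n (suc k) + ρ n k * V n k

  V-vanish : ∀ n k → n < k → V n k ≈ 0#
  V-vanish zero    (suc k) _ = refl
  V-vanish (suc n) (suc k) (s≤s n<k) = begin
    α n (suc k) * V n (suc k) + ρ n k * V n k
      ≈⟨ +-cong (*-congˡ (V-vanish n (suc k) (ℕₚ.m<n⇒m<1+n n<k))) (*-congˡ (V-vanish n k n<k)) ⟩
    α n (suc k) * 0# + ρ n k * 0#
      ≈⟨ solve 2 (λ a b → a :* con (+ 0) :+ b :* con (+ 0) := con (+ 0)) refl (α n (suc k)) (ρ n k) ⟩
    0# ∎

  newton-expansion : ∀ u v → u * v ≈ 1# → ∀ n →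
    poch (q * q * u) (pow q 3) n * poch (pow q 4 * v) (pow q 3) n
    ≈ sumTo n (λ k → V n k * (poch u q k * poch (q * q * v) q k))
  newton-expansion u v uv≈1 zero    = solve 0 (:1 :* :1 := :1 :* (:1 :* :1)) refl
  newton-expansion u v uv≈1 (suc n) = sym (begin
    sumTo (suc n) (λ k → V (suc n) k * φ k)
      ≈⟨ sumTo-pascal n (*-assoc _ _ _)
           (λ k _ → trans (distribʳ _ _ _) (+-cong (*-assoc _ _ _) (*-assoc _ _ _)))
           (trans (*-congˡ (trans (*-congʳ (V-vanish n (suc n) ℕₚ.≤-refl)) (zeroˡ _))) (zeroʳ _)) ⟩
    sumTo n (λ k → α n k * (V n k * φ k)) + sumTo n (λ k → ρ n k * (V n k * φ (suc k)))
      ≈⟨ sumTo-+ n _ _ ⟨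
    sumTo n (λ k → α n k * (V n k * φ k) + ρ n k * (V n k * φ (suc k)))
      ≈⟨ sumTo-cong n (λ k _ → step k) ⟩
    sumTo n (λ k → last * (V n k * φ k))
      ≈⟨ *-distribˡ-sumTo n last _ ⟨
    last * sumTo n (λ k → V n k * φ k)
      ≈⟨ *-congˡ (newton-expansion u v uv≈1 n) ⟨
    last * (poch (q * q * u) (pow q 3) n * poch (pow q 4 * v) (pow q 3) n)
      ≈⟨ solve 6 (λ q u v N a b →
            (:1 :- q :* q :* N :* u) :* (:1 :- q :* q :* (q :* q :* N) :* v) :* (a :* b)
         := a :* (:1 :- q :* q :* u :* N) :* (b :* (:1 :- q :* (q :* (q :* (q :* :1))) :* v :* N)))
         refl q u v (pow (pow q 3) n) _ _ ⟩
    poch (q * q * u) (pow q 3) (suc n) * poch (pow q 4 * v) (pow q 3) (suc n) ∎)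
    where
    φ : ℕ → Carrier
    φ k = poch u q k * poch (q * q * v) q k
    last : Carrier
    last = (1# - ν n * u) * (1# - q * q * ν n * v)
    -- Writing uv for one occurrence of 1 turns the expansion of the new factor in φ (suc k) into an identity of polynomials.
    new-factor : ∀ k → α n k + ρ n k * ((1# - u * pow q k) * (1# - q * q * v * pow q k)) ≈ last
    new-factor k = begin
      (1# - r) * (1# - q * q * ν n * K) + r * ((1# - u * K) * (1# - q * q * v * K))
        ≈⟨ +-congʳ (*-congˡ (+-congˡ (-‿cong (trans (sym (*-identityʳ _)) (*-cong (*-congʳ (*-congˡ (sym (ρ*qᵏ n k)))) (sym uv≈1)))))) ⟩
      (1# - r) * (1# - q * q * (r * K) * K * (u * v)) + r * ((1# - u * K) * (1# - q * q * v * K))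
        ≈⟨ solve 5 (λ r K q u v →
             (:1 :- r) :* (:1 :- q :* q :* (r :* K) :* K :* (u :* v)) :+ r :* ((:1 :- u :* K) :* (:1 :- q :* q :* v :* K))
          := (:1 :- r :* K :* u) :* (:1 :- q :* q :* (r :* K) :* v)) refl r K q u v ⟩
      (1# - r * K * u) * (1# - q * q * (r * K) * v)
        ≈⟨ *-cong (+-congˡ (-‿cong (*-congʳ (ρ*qᵏ n k)))) (+-congˡ (-‿cong (*-congʳ (*-congˡ (ρ*qᵏ n k))))) ⟩
      last ∎
      where
      r = ρ n k
      K = pow q k
    step : ∀ k → α n k * (V n k * φ k) + ρ n k * (V n k * φ (suc k)) ≈ last * (V n k * φ k)
    step k = trans
      (solve 7 (λ a r w f g f′ g′ → a :* (w :* (f :* g)) :+ r :* (w :* (f :* f′ :* (g :* g′)))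
          := (a :+ r :* (f′ :* g′)) :* (w :* (f :* g))) refl
        (α n k) (ρ n k) (V n k) (poch u q k) (poch (q * q * v) q k) (1# - u * pow q k) (1# - q * q * v * pow q k))
      (*-congʳ (new-factor k))

  ν-suc : ∀ n → ν (suc n) ≈ q * q * q * ν n
  ν-suc n = solve 2 (λ q a → q :* q :* (q :* (q :* (q :* :1)) :* a) := q :* q :* q :* (q :* q :* a)) refl q (pow (pow q 3) n)

  -- At N = q^(3n+2) and K = q^k, N - q K is N (1 - q^(k-1-3n)), while N - q² K³ in `ratioʳ` is N (1
  -- - q^(3k-3n)). The quotient of `ratioʳ` by `ratioˡ` is thus the term ratio of the ℓ = 0 summand
  -- with the factors x and q²/x removed.
  ratioˡ : Carrier → Carrier → Carrier
  ratioˡ N K = (1# - q * q * (K * K)) * (1# - q * q * q * (K * K)) * (N - q * K)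

  ratioʳ : Carrier → Carrier → Carrier
  ratioʳ N K = (N - q * q * (K * K * K)) * q

  -- For N = q r K one has (1 - r)(q³ N - q K) = -(q³ r - 1)(N - q K), which makes `ratioˡ N K`
  -- appear next to `w₊` so that the hypothesis applies. The surplus on the right is a multiple of
  -- `ratioˡ` with K replaced by K / q, ready for the contiguity relation at the previous k.
  ratio-step : ∀ {N r K w w₊} → N ≈ q * r * K → w₊ * ratioˡ N K ≈ w * ratioʳ N K →
    ((1# - r) * (1# - q * q * N * (q * K)) * w₊ + q * r * w) * ratioˡ (q * q * q * N) K
    ≈ (1# - q * r) * (1# - q * q * N * K) * w * ratioʳ (q * q * q * N) K
      + q * q * q * q * q * r * (w * ((1# - K * K) * (1# - q * (K * K)) * (N - K)))
  ratio-step {N} {r} {K} {w} {w₊} N≈qrK ih = begin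
    ((1# - r) * (1# - q * q * N * (q * K)) * w₊ + q * r * w) * ratioˡ (q * q * q * N) K
      ≈⟨ *-congˡ (*-congˡ (+-congʳ (*-congˡ N≈qrK))) ⟩
    ((1# - r) * (1# - q * q * N * (q * K)) * w₊ + q * r * w)
      * ((1# - q * q * (K * K)) * (1# - q * q * q * (K * K)) * (q * q * q * (q * r * K) - q * K))
      ≈⟨ solve 6 (λ q N r K w w₊ →
           ((:1 :- r) :* (:1 :- q :* q :* N :* (q :* K)) :* w₊ :+ q :* r :* w)
             :* ((:1 :- q :* q :* (K :* K)) :* (:1 :- q :* q :* q :* (K :* K)) :* (q :* q :* q :* (q :* r :* K) :- q :* K))
        := (:- ((:1 :- q :* q :* N :* (q :* K)) :* (q :* q :* q :* r :- :1)))
             :* (w₊ :* ((:1 :- q :* q :* (K :* K)) :* (:1 :- q :* q :* q :* (K :* K)) :* (q :* r :* K :- q :* K)))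
           :+ q :* r :* w :* ((:1 :- q :* q :* (K :* K)) :* (:1 :- q :* q :* q :* (K :* K)) :* (q :* q :* q :* (q :* r :* K) :- q :* K)))
         refl q N r K w w₊ ⟩
    c * (w₊ * ((1# - q * q * (K * K)) * (1# - q * q * q * (K * K)) * (q * r * K - q * K))) + d
      ≈⟨ +-congʳ (*-congˡ (trans (*-congˡ (*-congˡ (+-congʳ (sym N≈qrK)))) ih)) ⟩
    c * (w * ratioʳ N K) + d
      ≈⟨ +-congʳ (*-cong (-‿cong (*-congʳ (+-congˡ (-‿cong (*-congʳ (*-congˡ N≈qrK)))))) (*-congˡ (*-congʳ (+-congʳ N≈qrK)))) ⟩
    - ((1# - q * q * (q * r * K) * (q * K)) * (q * q * q * r - 1#)) * (w * ratioʳ (q * r * K) K) + d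
      ≈⟨ solve 5 (λ q r K w N →
           (:- ((:1 :- q :* q :* (q :* r :* K) :* (q :* K)) :* (q :* q :* q :* r :- :1)))
             :* (w :* ((q :* r :* K :- q :* q :* (K :* K :* K)) :* q))
           :+ q :* r :* w :* ((:1 :- q :* q :* (K :* K)) :* (:1 :- q :* q :* q :* (K :* K)) :* (q :* q :* q :* (q :* r :* K) :- q :* K))
        := (:1 :- q :* r) :* (:1 :- q :* q :* (q :* r :* K) :* K) :* w :* ((q :* q :* q :* (q :* r :* K) :- q :* q :* (K :* K :* K)) :* q)
           :+ q :* q :* q :* q :* q :* r :* (w :* ((:1 :- K :* K) :* (:1 :- q :* (K :* K)) :* (q :* r :* K :- K))))
         refl q r K w N ⟩
    (1# - q * r) * (1# - q * q * (q * r * K) * K) * w * ratioʳ (q * q * q * (q * r * K)) K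
      + q * q * q * q * q * r * (w * ((1# - K * K) * (1# - q * (K * K)) * (q * r * K - K)))
      ≈⟨ +-cong (*-cong (*-congʳ (*-congˡ (+-congˡ (-‿cong (*-congʳ (*-congˡ (sym N≈qrK)))))))
                        (*-congʳ (+-congʳ (*-congˡ (sym N≈qrK)))))
                (*-congˡ (*-congˡ (*-congˡ (+-congʳ (sym N≈qrK))))) ⟩
    (1# - q * r) * (1# - q * q * N * K) * w * ratioʳ (q * q * q * N) K
      + q * q * q * q * q * r * (w * ((1# - K * K) * (1# - q * (K * K)) * (N - K))) ∎
    where
    c = - ((1# - q * q * N * (q * K)) * (q * q * q * r - 1#))
    d = q * r * w * ((1# - q * q * (K * K)) * (1# - q * q * q * (K * K)) * (q * q * q * (q * r * K) - q * K))

  -- The ratio V n (k + 1) / V n k, cleared of denominators so that it survives at roots of unity.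
  V-ratio : ∀ n k → V n (suc k) * ratioˡ (ν n) (pow q k) ≈ V n k * ratioʳ (ν n) (pow q k)
  V-ratio zero zero =
    solve 1 (λ q → con (+ 0) :* ((:1 :- q :* q :* (:1 :* :1)) :* (:1 :- q :* q :* q :* (:1 :* :1)) :* (q :* q :* :1 :- q :* :1))
       := :1 :* ((q :* q :* :1 :- q :* q :* (:1 :* :1 :* :1)) :* q)) refl q
  V-ratio zero (suc k) = trans (zeroˡ _) (sym (zeroˡ _))
  V-ratio (suc n) k = begin
    V (suc n) (suc k) * ratioˡ (ν (suc n)) K
      ≈⟨ *-cong (+-congˡ (*-congʳ (ρ-suc n k))) (*-congˡ (+-congʳ (ν-suc n))) ⟩
    (α n (suc k) * V n (suc k) + q * r * V n k) * ratioˡ (q * q * q * ν n) K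
      ≈⟨ ratio-step (trans (sym (ρ*qᵏ n k)) (*-congʳ (ρ-suc n k))) (V-ratio n k) ⟩
    (1# - q * r) * (1# - q * q * ν n * K) * V n k * ratioʳ (q * q * q * ν n) K
      + q * q * q * q * q * r * (V n k * ((1# - K * K) * (1# - q * (K * K)) * (ν n - K)))
      ≈⟨ +-congʳ (*-congʳ (*-congʳ (*-congʳ (+-congˡ (-‿cong (sym (ρ-suc n k))))))) ⟩
    α n k * V n k * ratioʳ (q * q * q * ν n) K
      + q * q * q * q * q * r * (V n k * ((1# - K * K) * (1# - q * (K * K)) * (ν n - K)))
      ≈⟨ V-suc k ⟩
    V (suc n) k * ratioʳ (q * q * q * ν n) K
      ≈⟨ *-congˡ (*-congʳ (+-congʳ (ν-suc n))) ⟨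
    V (suc n) k * ratioʳ (ν (suc n)) K ∎
    where
    r = ρ n (suc k)
    K = pow q k
    -- The surplus dies at k = 0, where 1 - K² vanishes. Otherwise the contiguity relation one index
    -- lower, with the same n, turns it into the second term of the recursion for `V`; the powers of
    -- q agree because ρ n k = q² ρ n (k + 2).
    V-suc : ∀ k → α n k * V n k * ratioʳ (q * q * q * ν n) (pow q k)
      + q * q * q * q * q * ρ n (suc k) * (V n k * ((1# - pow q k * pow q k) * (1# - q * (pow q k * pow q k)) * (ν n - pow q k)))
      ≈ V (suc n) k * ratioʳ (q * q * q * ν n) (pow q k)
    V-suc zero = solve 5 (λ a b c q N →
         a :+ b :* (c :* ((:1 :- :1 :* :1) :* (:1 :- q :* (:1 :* :1)) :* (N :- :1))) := a) refl
         (α n 0 * V n 0 * ratioʳ (q * q * q * ν n) 1#) (q * q * q * q * q * ρ n 1) (V n 0) q (ν n)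
    V-suc (suc k) = begin
      α n (suc k) * V n (suc k) * R + q * q * q * q * q * r₂ * (V n (suc k) * ((1# - q * L * (q * L)) * (1# - q * (q * L * (q * L))) * (ν n - q * L)))
        ≈⟨ +-congˡ (*-congˡ (*-congˡ (solve 3 (λ q L N →
             (:1 :- q :* L :* (q :* L)) :* (:1 :- q :* (q :* L :* (q :* L))) :* (N :- q :* L)
          := (:1 :- q :* q :* (L :* L)) :* (:1 :- q :* q :* q :* (L :* L)) :* (N :- q :* L)) refl q L (ν n)))) ⟩
      α n (suc k) * V n (suc k) * R + q * q * q * q * q * r₂ * (V n (suc k) * ratioˡ (ν n) L)
        ≈⟨ +-congˡ (*-congˡ (V-ratio n k)) ⟩
      α n (suc k) * V n (suc k) * R + q * q * q * q * q * r₂ * (V n k * ratioʳ (ν n) L)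
        ≈⟨ solve 6 (λ q L N r₂ w e →
             e :* ((q :* q :* q :* N :- q :* q :* (q :* L :* (q :* L) :* (q :* L))) :* q)
               :+ q :* q :* q :* q :* q :* r₂ :* (w :* ((N :- q :* q :* (L :* L :* L)) :* q))
          := (e :+ q :* (q :* r₂) :* w) :* ((q :* q :* q :* N :- q :* q :* (q :* L :* (q :* L) :* (q :* L))) :* q))
           refl q L (ν n) r₂ (V n k) (α n (suc k) * V n (suc k)) ⟩
      (α n (suc k) * V n (suc k) + q * (q * r₂) * V n k) * R
        ≈⟨ *-congʳ (+-congˡ (*-congʳ (trans (ρ-suc n k) (*-congˡ (ρ-suc n (suc k)))))) ⟨
      V (suc n) (suc k) * R ∎
      where
      L = pow q k
      r₂ = ρ n (suc (suc k))
      R = ratioʳ (q * q * q * ν n) (q * L)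

  V-zero : ∀ n → V n 0 ≈ poch (q * q) (pow q 3) n * poch (pow q 4) (pow q 3) n
  V-zero zero    = sym (*-identityˡ 1#)
  V-zero (suc n) = trans (*-congˡ (V-zero n))
    (solve 4 (λ q N a b → (:1 :- q :* q :* N :* :1) :* (:1 :- q :* q :* (q :* q :* N) :* :1) :* (a :* b)
       := a :* (:1 :- q :* q :* N) :* (b :* (:1 :- q :* (q :* (q :* (q :* :1))) :* N))) refl
       q (pow (pow q 3) n) (poch (q * q) (pow q 3) n) (poch (pow q 4) (pow q 3) n))

  -- Induction on k: multiplying `V-ratio` by p² ε, the inverse of `ν n`, produces exactly the
  -- factors gained by the products, after q t² = 1 has merged (1 - q² t K)(1 + q² t K) into 1 - q³
  -- K². Here q² t = q^(3/2) and ε = q^(-3n). The product form remains meaningful when (-q^(3/2);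
  -- q)_k vanishes.
  V-closed : ∀ n k → let ε = pow (pow p 3) n in
    V n k * (poch q q k * poch (- q) q k * poch (q * q * t) q k * poch (- (q * q * t)) q k * poch (p * ε) q k)
    ≈ poch (q * q) (pow q 3) n * poch (pow q 4) (pow q 3) n * poch ε (pow q 3) k * pow q k
  V-closed n zero    = trans (*-congʳ (V-zero n))
    (solve 1 (λ a → a :* (:1 :* :1 :* :1 :* :1 :* :1) := a :* :1 :* :1) refl _)
  V-closed n (suc k) = begin
    V n (suc k) * (a₁ * (1# - q * K) * (a₂ * (1# - - q * K)) * (a₃ * (1# - q * q * t * K)) * (a₄ * (1# - - (q * q * t) * K)) * (a₅ * (1# - p * ε * K)))
      ≈⟨ solve 11 (λ q p t K ε w a₁ a₂ a₃ a₄ a₅ →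
           w :* (a₁ :* (:1 :- q :* K) :* (a₂ :* (:1 :- (:- q) :* K)) :* (a₃ :* (:1 :- q :* q :* t :* K)) :* (a₄ :* (:1 :- (:- (q :* q :* t)) :* K)) :* (a₅ :* (:1 :- p :* ε :* K)))
        := a₁ :* a₂ :* a₃ :* a₄ :* a₅ :* (w :* ((:1 :- q :* q :* (K :* K)) :* (:1 :- q :* q :* q :* (K :* K) :* (q :* (t :* t))) :* (:1 :- p :* ε :* K))))
         refl q p t K ε (V n (suc k)) a₁ a₂ a₃ a₄ a₅ ⟩
    a₁ * a₂ * a₃ * a₄ * a₅ * (V n (suc k) * ((1# - q * q * (K * K)) * (1# - q * q * q * (K * K) * (q * (t * t))) * (1# - p * ε * K)))
      ≈⟨ *-congˡ ratio ⟩
    a₁ * a₂ * a₃ * a₄ * a₅ * (V n k * ((1# - ε * pow (pow q 3) k) * q))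
      ≈⟨ solve 8 (λ a₁ a₂ a₃ a₄ a₅ w e q → a₁ :* a₂ :* a₃ :* a₄ :* a₅ :* (w :* (e :* q))
          := w :* (a₁ :* a₂ :* a₃ :* a₄ :* a₅) :* (e :* q)) refl a₁ a₂ a₃ a₄ a₅ (V n k) (1# - ε * pow (pow q 3) k) q ⟩
    V n k * (a₁ * a₂ * a₃ * a₄ * a₅) * ((1# - ε * pow (pow q 3) k) * q)
      ≈⟨ *-congʳ (V-closed n k) ⟩
    b * c * d * K * ((1# - ε * pow (pow q 3) k) * q)
      ≈⟨ solve 6 (λ b c d K e q → b :* c :* d :* K :* (e :* q) := b :* c :* (d :* e) :* (q :* K)) refl b c d K (1# - ε * pow (pow q 3) k) q ⟩
    b * c * (d * (1# - ε * pow (pow q 3) k)) * (q * K) ∎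
    where
    ε = pow (pow p 3) n
    K = pow q k
    N = pow (pow q 3) n
    a₁ = poch q q k
    a₂ = poch (- q) q k
    a₃ = poch (q * q * t) q k
    a₄ = poch (- (q * q * t)) q k
    a₅ = poch (p * ε) q k
    b = poch (q * q) (pow q 3) n
    c = poch (pow q 4) (pow q 3) n
    d = poch ε (pow q 3) k
    pp : Carrier
    pp = p * p * ε
    ν-unit : ν n * pp ≈ 1#
    ν-unit = begin
      q * q * N * (p * p * ε)     ≈⟨ solve 4 (λ q N p e → q :* q :* N :* (p :* p :* e) := q :* p :* (q :* p) :* (N :* e)) refl q N p ε ⟩
      q * p * (q * p) * (N * ε)   ≈⟨ *-cong (*-cong qp≈1 qp≈1) (pow-inverse (trans (sym (pow-* q p 3)) (trans (pow-cong qp≈1 3) (pow-1 3))) n) ⟩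
      1# * 1# * 1#                ≈⟨ solve 0 (:1 :* :1 :* :1 := :1) refl ⟩
      1#                          ∎
    q-pp : q * pp ≈ p * ε
    q-pp = trans (solve 3 (λ q p e → q :* (p :* p :* e) := q :* p :* (p :* e)) refl q p ε) (trans (*-congʳ qp≈1) (*-identityˡ _))
    qq-pp : q * q * pp ≈ ε
    qq-pp = trans (solve 3 (λ q p e → q :* q :* (p :* p :* e) := q :* p :* (q :* p) :* e) refl q p ε)
      (trans (*-congʳ (trans (*-cong qp≈1 qp≈1) (*-identityˡ _))) (*-identityˡ _))
    K³ : K * K * K ≈ pow (pow q 3) k
    K³ = begin
      K * K * K             ≈⟨ solve 1 (λ K → K :* K :* K := K :* (K :* (K :* :1))) refl K ⟩
      pow (pow q k) 3       ≈⟨ pow-pow q k 3 ⟨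
      pow q (k ℕ.* 3)       ≡⟨ ≡.cong (pow q) (ℕₚ.*-comm k 3) ⟩
      pow q (3 ℕ.* k)       ≈⟨ pow-pow q 3 k ⟩
      pow (pow q 3) k       ∎
    ratio : V n (suc k) * ((1# - q * q * (K * K)) * (1# - q * q * q * (K * K) * (q * (t * t))) * (1# - p * ε * K))
      ≈ V n k * ((1# - ε * pow (pow q 3) k) * q)
    ratio = begin
      V n (suc k) * ((1# - q * q * (K * K)) * (1# - q * q * q * (K * K) * (q * (t * t))) * (1# - p * ε * K))
        ≈⟨ *-congˡ (*-cong (*-congˡ (+-congˡ (-‿cong (trans (*-congˡ qtt≈1) (*-identityʳ _)))))
             (+-cong (sym ν-unit) (-‿cong (*-congʳ (sym q-pp))))) ⟩
      V n (suc k) * ((1# - q * q * (K * K)) * (1# - q * q * q * (K * K)) * (ν n * pp - q * pp * K))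
        ≈⟨ solve 7 (λ w x y N u q K → w :* (x :* y :* (N :* u :- q :* u :* K)) := u :* (w :* (x :* y :* (N :- q :* K)))) refl
             (V n (suc k)) (1# - q * q * (K * K)) (1# - q * q * q * (K * K)) (ν n) pp q K ⟩
      pp * (V n (suc k) * ratioˡ (ν n) K)
        ≈⟨ *-congˡ (V-ratio n k) ⟩
      pp * (V n k * ratioʳ (ν n) K)
        ≈⟨ solve 5 (λ w N u q C → u :* (w :* ((N :- q :* q :* C) :* q)) := w :* ((N :* u :- q :* q :* u :* C) :* q)) refl
             (V n k) (ν n) pp q (K * K * K) ⟩
      V n k * ((ν n * pp - q * q * pp * (K * K * K)) * q)
        ≈⟨ *-congˡ (*-congʳ (+-cong ν-unit (-‿cong (*-cong qq-pp K³)))) ⟩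
      V n k * ((1# - ε * pow (pow q 3) k) * q) ∎

-- The terminating very-well-poised ₆φ₅ expansion.

module WellPoisedExpansion {o ℓ} (F : CharZeroField o ℓ) (base : SquareRootBase F) where
  open CharZeroField F
  open SquareRootBase base
  open Basic F
  open FieldProperties F
  open IntegerCoefficients commutativeRing
  open import Relation.Binary.Reasoning.Setoid setoid

  P : ℕ → Carrier → Carrier
  P zero    y = 1#
  P (suc l) y = P l y * (y + pow q l * t)

  P-1 : ∀ l → P l 1# ≈ poch (- t) q l
  P-1 zero    = refl
  P-1 (suc l) = *-cong (P-1 l) (solve 2 (λ b t → :1 :+ b :* t := :1 :- (:- t) :* b) refl (pow q l) t)

  -- Replacing y by q y moves each factor of the product onto its neighbour up to a power of q, so
  -- only the two end factors survive in the ratio; q t² = 1 brings them to the form shown.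
  P-shift : ∀ l y → P l (q * y) * (1# - - (q * q * t * pow p l) * y) ≈ (1# - - (q * q * t) * y) * P l y
  P-shift zero    y = solve 2 (λ a y → :1 :* (:1 :- (:- (a :* :1)) :* y) := (:1 :- (:- a) :* y) :* :1) refl (q * q * t) y
  P-shift (suc l) y = begin
    P l (q * y) * (q * y + b * t) * (1# - - (q * q * t * (p * b′)) * y)
      ≈⟨ *-congʳ (*-congˡ (begin
           q * y + b * t                                      ≈⟨ +-congʳ (trans (sym (*-identityʳ _)) (*-congˡ (sym bb′qtt≈1))) ⟩
           q * y * (b * b′ * (q * (t * t))) + b * t           ≈⟨ solve 5 (λ q y b b′ t → q :* y :* (b :* b′ :* (q :* (t :* t))) :+ b :* t
                                                                   := b :* t :* (:1 :- (:- (q :* q :* t :* b′)) :* y)) refl q y b b′ t ⟩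
           b * t * (1# - - (q * q * t * b′) * y)              ∎)) ⟩
    P l (q * y) * (b * t * (1# - - (q * q * t * b′) * y)) * (1# - - (q * q * t * (p * b′)) * y)
      ≈⟨ solve 8 (λ q p t b b′ y A e → A :* (b :* t :* e) :* (:1 :- (:- (q :* q :* t :* (p :* b′))) :* y)
          := A :* e :* (b :* t :+ q :* p :* (b :* b′ :* (q :* (t :* t))) :* y)) refl
          q p t b b′ y (P l (q * y)) (1# - - (q * q * t * b′) * y) ⟩
    P l (q * y) * (1# - - (q * q * t * b′) * y) * (b * t + q * p * (b * b′ * (q * (t * t))) * y)
      ≈⟨ *-cong (P-shift l y) (trans (+-congˡ (trans (*-congʳ (trans (*-cong qp≈1 bb′qtt≈1) (*-identityˡ 1#))) (*-identityˡ y))) (+-comm _ _)) ⟩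
    (1# - - (q * q * t) * y) * P l y * (y + b * t)
      ≈⟨ *-assoc _ _ _ ⟩
    (1# - - (q * q * t) * y) * (P l y * (y + b * t)) ∎
    where
    b  = pow q l
    b′ = pow p l
    bb′qtt≈1 : b * b′ * (q * (t * t)) ≈ 1#
    bb′qtt≈1 = trans (*-cong (pow-inverse qp≈1 l) qtt≈1) (*-identityˡ 1#)

  -- Induction on k with `P-shift` as the step. It trades (-q^(3/2); q)_k for (-q^(3/2-l); q)_k
  -- without dividing by either.
  poch-P : ∀ l k → poch (- (q * q * t)) q k * poch (- t) q l ≈ poch (- (q * q * t * pow p l)) q k * P l (pow q k)
  poch-P l zero    = *-congˡ (sym (P-1 l))
  poch-P l (suc k) = begin
    A * a * poch (- t) q l                     ≈⟨ solve 3 (λ A a b → A :* a :* b := a :* (A :* b)) refl A a _ ⟩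
    a * (A * poch (- t) q l)                   ≈⟨ *-congˡ (poch-P l k) ⟩
    a * (B * P l (pow q k))                    ≈⟨ solve 3 (λ a B b → a :* (B :* b) := B :* (a :* b)) refl a B _ ⟩
    B * (a * P l (pow q k))                    ≈⟨ *-congˡ (P-shift l (pow q k)) ⟨
    B * (P l (q * pow q k) * b)                ≈⟨ solve 3 (λ B a b → B :* (a :* b) := B :* b :* a) refl B _ b ⟩
    B * b * P l (q * pow q k)                  ∎
    where
    A = poch (- (q * q * t)) q k
    B = poch (- (q * q * t * pow p l)) q k
    a = 1# - - (q * q * t) * pow q k
    b = 1# - - (q * q * t * pow p l) * pow q k

  -- The coefficient of yⁱ in ∏_{j<l} (1 + t qʲ y): a Gaussian binomial coefficient times a power of t and q.
  H : ℕ → ℕ → Carrier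
  H zero    zero    = 1#
  H zero    (suc i) = 0#
  H (suc l) zero    = 1#
  H (suc l) (suc i) = H l (suc i) + pow q l * t * H l i

  H-zero : ∀ l → H l 0 ≈ 1#
  H-zero zero    = refl
  H-zero (suc l) = refl

  H-vanish : ∀ l i → l < i → H l i ≈ 0#
  H-vanish zero    (suc i) _ = refl
  H-vanish (suc l) (suc i) (s≤s l<i) = begin
    H l (suc i) + pow q l * t * H l i  ≈⟨ +-cong (H-vanish l (suc i) (ℕₚ.m<n⇒m<1+n l<i)) (*-congˡ (H-vanish l i l<i)) ⟩
    0# + pow q l * t * 0#              ≈⟨ solve 1 (λ a → con (+ 0) :+ a :* con (+ 0) := con (+ 0)) refl (pow q l * t) ⟩
    0#                                 ∎

  -- The quotient of consecutive q-binomial coefficients, cleared of its denominator. It accounts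
  -- for the difference between the recursion defining `H` and the other q-Pascal rule.
  H-ratio : ∀ l i → (1# - q * pow q i) * H l (suc i) ≈ t * (pow q i - pow q l) * H l i
  H-ratio zero    zero    = solve 2 (λ q t → (:1 :- q :* :1) :* con (+ 0) := t :* (:1 :- :1) :* :1) refl q t
  H-ratio zero    (suc i) = trans (zeroʳ _) (sym (zeroʳ _))
  H-ratio (suc l) zero    = begin
    (1# - q * 1#) * (H l 1 + b * t * H l 0)             ≈⟨ distribˡ _ _ _ ⟩
    (1# - q * 1#) * H l 1 + (1# - q * 1#) * (b * t * H l 0)
      ≈⟨ +-cong (trans (H-ratio l 0) (*-congˡ (H-zero l))) (*-congˡ (*-congˡ (H-zero l))) ⟩
    t * (1# - b) * 1# + (1# - q * 1#) * (b * t * 1#)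
      ≈⟨ solve 3 (λ q b t → t :* (:1 :- b) :* :1 :+ (:1 :- q :* :1) :* (b :* t :* :1) := t :* (:1 :- q :* b) :* :1) refl q b t ⟩
    t * (1# - q * b) * 1#                               ∎
    where b = pow q l
  H-ratio (suc l) (suc i) = begin
    (1# - q * (q * a)) * (H l (suc (suc i)) + b * t * H l (suc i))
      ≈⟨ distribˡ _ _ _ ⟩
    (1# - q * (q * a)) * H l (suc (suc i)) + (1# - q * (q * a)) * (b * t * H l (suc i))
      ≈⟨ +-congʳ (H-ratio l (suc i)) ⟩
    t * (q * a - b) * H l (suc i) + (1# - q * (q * a)) * (b * t * H l (suc i))
      ≈⟨ solve 5 (λ q a b t h → t :* (q :* a :- b) :* h :+ (:1 :- q :* (q :* a)) :* (b :* t :* h)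
           := t :* (q :* a :- q :* b) :* h :+ t :* b :* q :* ((:1 :- q :* a) :* h)) refl q a b t (H l (suc i)) ⟩
    t * (q * a - q * b) * H l (suc i) + t * b * q * ((1# - q * a) * H l (suc i))
      ≈⟨ +-congˡ (*-congˡ (H-ratio l i)) ⟩
    t * (q * a - q * b) * H l (suc i) + t * b * q * (t * (a - b) * H l i)
      ≈⟨ solve 6 (λ q a b t h h′ → t :* (q :* a :- q :* b) :* h :+ t :* b :* q :* (t :* (a :- b) :* h′)
           := t :* (q :* a :- q :* b) :* (h :+ b :* t :* h′)) refl q a b t (H l (suc i)) (H l i) ⟩
    t * (q * a - q * b) * (H l (suc i) + b * t * H l i) ∎
    where
    a = pow q i
    b = pow q l

  -- This is (X; q)_l (1 - X q^i) / (1 - X) with 1 - X already cancelled, which requires l ≥ 1. For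
  -- l = 0 only i = 0 matters, where the quotient is 1.
  g : ℕ → ℕ → Carrier → Carrier
  g zero    i X = 1#
  g (suc l) i X = poch (q * X) q l * (1# - X * pow q i)

  -- The factor `H l i` is kept on both sides because at l = 0 the relation for `g` alone can fail
  -- for i > 0, where `H` vanishes. The same holds for `H*g-shift`.
  H*g-stay : ∀ l i X → H l i * ((1# - X * pow q l) * g l i X) ≈ H l i * (poch (q * X) q l * (1# - X * pow q i))
  H*g-stay zero    zero    X = *-congˡ (*-comm _ _)
  H*g-stay zero    (suc i) X = trans (zeroˡ _) (sym (zeroˡ _))
  H*g-stay (suc l) i       X = *-congˡ (solve 5 (λ X q b P e →
      (:1 :- X :* (q :* b)) :* (P :* e) := P :* (:1 :- q :* X :* b) :* e) refl
      X q (pow q l) (poch (q * X) q l) (1# - X * pow q i))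

  H*g-shift : ∀ l i X → H l i * ((1# - q * X) * g l i (q * X)) ≈ H l i * (poch (q * X) q l * (1# - X * pow q (suc i)))
  H*g-shift zero    zero    X = *-congˡ (solve 2 (λ q X → (:1 :- q :* X) :* :1 := :1 :* (:1 :- X :* (q :* :1))) refl q X)
  H*g-shift zero    (suc i) X = trans (zeroˡ _) (sym (zeroˡ _))
  H*g-shift (suc l) i       X = *-congˡ (begin
    (1# - q * X) * (poch (q * (q * X)) q l * (1# - q * X * pow q i))  ≈⟨ *-assoc _ _ _ ⟨
    (1# - q * X) * poch (q * (q * X)) q l * (1# - q * X * pow q i)    ≈⟨ *-cong (sym (poch-suc (q * X) q l))
                                                                          (solve 3 (λ q X a → :1 :- q :* X :* a := :1 :- X :* (q :* a)) refl q X (pow q i)) ⟩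
    poch (q * X) q (suc l) * (1# - X * pow q (suc i))                 ∎)

  -- Both (1 - X)(q X; q)_i and (X; q)_i (1 - X q^i) are (X; q)_{i+1}.
  g-closed : ∀ l i X → i ≤ l → poch X q l * poch (q * X) q i ≈ g l i X * poch X q i
  g-closed zero    zero X z≤n = refl
  g-closed (suc l) i    X _   = begin
    poch X q (suc l) * poch (q * X) q i                       ≈⟨ *-congʳ (poch-suc X q l) ⟩
    (1# - X) * poch (q * X) q l * poch (q * X) q i            ≈⟨ solve 3 (λ a b c → a :* b :* c := b :* (a :* c)) refl _ _ _ ⟩
    poch (q * X) q l * ((1# - X) * poch (q * X) q i)          ≈⟨ *-congˡ (poch-suc X q i) ⟨
    poch (q * X) q l * (poch X q i * (1# - X * pow q i))      ≈⟨ solve 3 (λ a b c → a :* (b :* c) := a :* c :* b) refl _ _ _ ⟩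
    poch (q * X) q l * (1# - X * pow q i) * poch X q i        ∎

  -- A very-well-poised coefficient with parameter X². Its X²-denominators are gathered into one run
  -- of consecutive factors, so that the terms compared in the induction on l differ there by a
  -- single end factor.
  D : ℕ → ℕ → Carrier → Carrier
  D l i X = H l i * g l i X * poch (- (q * X * t)) q l * (1# - X * X * pow q i * pow q i)
          * (poch (X * X * pow q i) q (suc l)) ⁻¹

  D-vanish : ∀ l X → D l (suc l) X ≈ 0#
  D-vanish l X = begin
    H l (suc l) * a * b * c * d  ≈⟨ *-congʳ (*-congʳ (*-congʳ (*-congʳ (H-vanish l (suc l) ℕₚ.≤-refl)))) ⟩
    0# * a * b * c * d           ≈⟨ solve 4 (λ a b c d → con (+ 0) :* a :* b :* c :* d := con (+ 0)) refl a b c d ⟩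
    0#                           ∎
    where
    a = g l (suc l) X
    b = poch (- (q * X * t)) q l
    c = 1# - X * X * pow q (suc l) * pow q (suc l)
    d = (poch (X * X * pow q (suc l)) q (suc l)) ⁻¹

  -- The runs of exponents i, ..., i + l with i ≤ l fill 0, ..., 2l. The range for l + 1 at X
  -- contains that for l at X and, since (q X)² adds 2 to each exponent, that for l at q X.
  Admissible : ℕ → Carrier → Set ℓ
  Admissible l X = ∀ j → j ≤ l ℕ.+ l → ¬ (1# - X * X * pow q j ≈ 0#)

  Admissible-poch : ∀ l X → Admissible l X → ∀ i → i ≤ l → ¬ (poch (X * X * pow q i) q (suc l) ≈ 0#)
  Admissible-poch l X adm i i≤l = poch-nonzero _ q (suc l) (λ j j<1+l → nonzero-resp
    (+-congˡ (-‿cong (trans (*-congˡ (pow-+ q i j)) (sym (*-assoc _ _ _)))))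
    (adm (i ℕ.+ j) (ℕₚ.+-mono-≤ i≤l (ℕₚ.≤-pred j<1+l))))

  Admissible-stay : ∀ l X → Admissible (suc l) X → Admissible l X
  Admissible-stay l X adm j j≤ = adm j (ℕₚ.≤-trans j≤ (ℕₚ.+-mono-≤ (ℕₚ.n≤1+n l) (ℕₚ.n≤1+n l)))

  Admissible-shift : ∀ l X → Admissible (suc l) X → Admissible l (q * X)
  Admissible-shift l X adm j j≤ = nonzero-resp
    (solve 3 (λ q X a → :1 :- X :* X :* (q :* (q :* a)) := :1 :- q :* X :* (q :* X) :* a) refl q X (pow q j))
    (adm (suc (suc j)) (ℕₚ.≤-trans (s≤s (s≤s j≤)) (ℕₚ.≤-reflexive (≡.cong suc (≡.sym (ℕₚ.+-suc l l))))))

  D-pascal-zero : ∀ l X → Admissible (suc l) X →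
    (1# - X * X * pow q (suc l)) * D (suc l) 0 X
    ≈ (1# - X * pow q l) * (1# + q * X * t * pow q l) * D l 0 X
  D-pascal-zero l X adm = sym (begin
    (1# - X * b) * (1# + q * X * t * b) * (H l 0 * g l 0 X * r * e * z ⁻¹)
      ≈⟨ *-congˡ (*-congˡ (⁻¹-factorˡ (Admissible-poch (suc l) X adm 0 z≤n) refl)) ⟩
    (1# - X * b) * (1# + q * X * t * b) * (H l 0 * g l 0 X * r * e * (w * ζ))
      ≈⟨ solve 8 (λ u v h g r e w z → u :* v :* (h :* g :* r :* e :* (w :* z)) := h :* (u :* g) :* (v :* r :* e :* w :* z)) refl
           (1# - X * b) (1# + q * X * t * b) (H l 0) (g l 0 X) r e w ζ ⟩
    H l 0 * ((1# - X * b) * g l 0 X) * ((1# + q * X * t * b) * r * e * w * ζ)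
      ≈⟨ *-congʳ (trans (H*g-stay l 0 X) (*-congʳ (H-zero l))) ⟩
    1# * (poch (q * X) q l * (1# - X * 1#)) * ((1# + q * X * t * b) * r * e * w * ζ)
      ≈⟨ solve 9 (λ q X t b g r e W z →
           :1 :* g :* ((:1 :+ q :* X :* t :* b) :* r :* e :* (:1 :- X :* X :* :1 :* W) :* z)
           := (:1 :- X :* X :* W) :* (:1 :* g :* (r :* (:1 :- (:- (q :* X :* t)) :* b)) :* e :* z)) refl
           q X t b (poch (q * X) q l * (1# - X * 1#)) r e (pow q (suc l)) ζ ⟩
    (1# - X * X * pow q (suc l)) * D (suc l) 0 X ∎)
    where
    b = pow q l
    r = poch (- (q * X * t)) q l
    e = 1# - X * X * 1# * 1#
    z = poch (X * X * 1#) q (suc l)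
    w = 1# - X * X * 1# * pow q (suc l)
    ζ = (poch (X * X * 1#) q (suc (suc l))) ⁻¹

  -- Both sides are linear in W: the constant terms give the recursion defining `H`, and the
  -- coefficients of W give the other q-Pascal rule. `H-ratio` passes from one to the other.
  H-well-poised : ∀ l i W →
    (1# - W * pow q (suc l)) * H (suc l) (suc i)
    ≈ (1# - W * pow q (suc i) * pow q (suc l)) * H l (suc i) + pow q l * t * (1# - W * pow q (suc i)) * H l i
  H-well-poised l i W = begin
    (1# - W * (q * b)) * (h₁ + b * t * h)
      ≈⟨ solve 7 (λ W q a b t h₁ h → (:1 :- W :* (q :* b)) :* (h₁ :+ b :* t :* h)
           := (:1 :- W :* (q :* a) :* (q :* b)) :* h₁ :+ b :* t :* (:1 :- W :* (q :* a)) :* h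
              :- W :* q :* b :* ((:1 :- q :* a) :* h₁ :- t :* (a :- b) :* h)) refl W q a b t h₁ h ⟩
    rhs - W * q * b * ((1# - q * a) * h₁ - t * (a - b) * h)
      ≈⟨ +-congˡ (-‿cong (*-congˡ (+-congʳ (H-ratio l i)))) ⟩
    rhs - W * q * b * (t * (a - b) * h - t * (a - b) * h)
      ≈⟨ solve 3 (λ r a b → r :- a :* (b :- b) := r) refl rhs (W * q * b) (t * (a - b) * h) ⟩
    rhs ∎
    where
    a  = pow q i
    b  = pow q l
    h  = H l i
    h₁ = H l (suc i)
    rhs = (1# - W * (q * a) * (q * b)) * h₁ + b * t * (1# - W * (q * a)) * h

  -- The multipliers are those of `contiguous`, so coefficients and products obey matching
  -- relations. Relative to the longest run `Z`, the two shorter denominators lack its last factor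
  -- `w` and its first factor `v`; once the common `G` is taken out, `H-well-poised` at W = X²
  -- remains.
  D-pascal-suc : ∀ l i X → i ≤ l → Admissible (suc l) X →
    (1# - X * X * pow q (suc l)) * D (suc l) (suc i) X
    ≈ (1# - X * pow q l) * (1# + q * X * t * pow q l) * D l (suc i) X
      + pow q l * t * (1# - q * X) * (1# + q * X * t) * D l i (q * X)
  D-pascal-suc l i X i≤l adm = sym (begin
    (1# - X * b) * (1# + q * X * t * b) * D l (suc i) X + b * t * (1# - q * X) * (1# + q * X * t) * D l i (q * X)
      ≈⟨ +-cong stay shift ⟩
    G * ((1# - X * X * pow q (suc i) * pow q (suc l)) * H l (suc i)) + G * (b * t * (1# - X * X * pow q (suc i)) * H l i)
      ≈⟨ distribˡ _ _ _ ⟨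
    G * ((1# - X * X * pow q (suc i) * pow q (suc l)) * H l (suc i) + b * t * (1# - X * X * pow q (suc i)) * H l i)
      ≈⟨ *-congˡ (H-well-poised l i (X * X)) ⟨
    G * ((1# - X * X * pow q (suc l)) * H (suc l) (suc i))
      ≈⟨ solve 6 (λ g r e z c h → g :* r :* e :* z :* (c :* h) := c :* (h :* g :* r :* e :* z)) refl
           γ r e ζ (1# - X * X * pow q (suc l)) (H (suc l) (suc i)) ⟩
    (1# - X * X * pow q (suc l)) * D (suc l) (suc i) X ∎)
    where
    b = pow q l
    γ = poch (q * X) q l * (1# - X * pow q (suc i))
    r = poch (- (q * X * t)) q (suc l)
    e = 1# - X * X * pow q (suc i) * pow q (suc i)
    Z = poch (X * X * pow q (suc i)) q (suc (suc l))
    ζ = Z ⁻¹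
    G = γ * r * e * ζ
    Z≉0 : ¬ (Z ≈ 0#)
    Z≉0 = Admissible-poch (suc l) X adm (suc i) (s≤s i≤l)
    w = 1# - X * X * pow q (suc i) * pow q (suc l)
    stay : (1# - X * b) * (1# + q * X * t * b) * D l (suc i) X ≈ G * (w * H l (suc i))
    stay = begin
      (1# - X * b) * (1# + q * X * t * b) * (H l (suc i) * g l (suc i) X * r′ * e * (poch (X * X * pow q (suc i)) q (suc l)) ⁻¹)
        ≈⟨ *-congˡ (*-congˡ (⁻¹-factorˡ Z≉0 refl)) ⟩
      (1# - X * b) * (1# + q * X * t * b) * (H l (suc i) * g l (suc i) X * r′ * e * (w * ζ))
        ≈⟨ solve 8 (λ u v h g r e w z → u :* v :* (h :* g :* r :* e :* (w :* z)) := h :* (u :* g) :* (v :* r :* e :* w :* z)) refl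
             (1# - X * b) (1# + q * X * t * b) (H l (suc i)) (g l (suc i) X) r′ e w ζ ⟩
      H l (suc i) * ((1# - X * b) * g l (suc i) X) * ((1# + q * X * t * b) * r′ * e * w * ζ)
        ≈⟨ *-congʳ (H*g-stay l (suc i) X) ⟩
      H l (suc i) * γ * ((1# + q * X * t * b) * r′ * e * w * ζ)
        ≈⟨ solve 8 (λ h g u b r e w z → h :* g :* ((:1 :+ u :* b) :* r :* e :* w :* z)
             := g :* (r :* (:1 :- (:- u) :* b)) :* e :* z :* (w :* h)) refl (H l (suc i)) γ (q * X * t) b r′ e w ζ ⟩
      G * (w * H l (suc i)) ∎
      where r′ = poch (- (q * X * t)) q l
    v = 1# - X * X * pow q (suc i)
    shift : b * t * (1# - q * X) * (1# + q * X * t) * D l i (q * X) ≈ G * (b * t * v * H l i)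
    shift = begin
      b * t * (1# - q * X) * (1# + q * X * t) * (H l i * g l i (q * X) * r′ * e′ * (poch (q * X * (q * X) * pow q i) q (suc l)) ⁻¹)
        ≈⟨ *-congˡ (*-congˡ (⁻¹-factorˡ Z≉0 Z-shift)) ⟩
      b * t * (1# - q * X) * (1# + q * X * t) * (H l i * g l i (q * X) * r′ * e′ * (v * ζ))
        ≈⟨ solve 10 (λ b t u s h g r e v z → b :* t :* u :* (:1 :+ s) :* (h :* g :* r :* e :* (v :* z))
             := h :* (u :* g) :* (b :* t :* ((:1 :- (:- s)) :* r) :* e :* v :* z)) refl
             b t (1# - q * X) (q * X * t) (H l i) (g l i (q * X)) r′ e′ v ζ ⟩
      H l i * ((1# - q * X) * g l i (q * X)) * (b * t * ((1# - - (q * X * t)) * r′) * e′ * v * ζ)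
        ≈⟨ *-cong (H*g-shift l i X) (*-congʳ (*-congʳ (*-cong (*-congˡ r-shift) e-shift))) ⟩
      H l i * γ * (b * t * r * e * v * ζ)
        ≈⟨ solve 8 (λ h g b t r e v z → h :* g :* (b :* t :* r :* e :* v :* z) := g :* r :* e :* z :* (b :* t :* v :* h)) refl
             (H l i) γ b t r e v ζ ⟩
      G * (b * t * v * H l i) ∎
      where
      r′ = poch (- (q * (q * X) * t)) q l
      e′ = 1# - q * X * (q * X) * pow q i * pow q i
      r-shift : (1# - - (q * X * t)) * r′ ≈ r
      r-shift = trans (*-congˡ (poch-congˡ q l (solve 3 (λ q X t → :- (q :* (q :* X) :* t) := q :* (:- (q :* X :* t))) refl q X t)))
        (sym (poch-suc (- (q * X * t)) q l))
      e-shift : e′ ≈ e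
      e-shift = solve 3 (λ q X a → :1 :- q :* X :* (q :* X) :* a :* a := :1 :- X :* X :* (q :* a) :* (q :* a)) refl q X (pow q i)
      Z-shift : Z ≈ poch (q * X * (q * X) * pow q i) q (suc l) * v
      Z-shift = trans (poch-suc _ q (suc l)) (trans (*-comm _ _) (*-congʳ (poch-congˡ q (suc l)
        (solve 3 (λ q X a → q :* (X :* X :* (q :* a)) := q :* X :* (q :* X) :* a) refl q X (pow q i)))))

  -- The three terms are linear in qᵏ after removing their common factors; the two last summands collect multiples of 1 - z X qˡ and 1 - q t².
  contiguous : ∀ l X z → z * (X * pow q l) ≈ 1# → ∀ k →
    (1# - X * X * pow q (suc l)) * ((pow q k + pow q l * t) * (poch (q * X) q k * poch z q k))
    ≈ (1# - X * pow q l) * (1# + q * X * t * pow q l) * (poch (q * X) q k * poch (q * z) q k)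
      + pow q l * t * (1# - q * X) * (1# + q * X * t) * (poch (q * (q * X)) q k * poch z q k)
  contiguous l X z zXb≈1 zero = trans
    (solve 4 (λ q X b t →
       (:1 :- X :* X :* (q :* b)) :* ((:1 :+ b :* t) :* (:1 :* :1))
    := (:1 :- X :* b) :* (:1 :+ q :* X :* t :* b) :* (:1 :* :1) :+ b :* t :* (:1 :- q :* X) :* (:1 :+ q :* X :* t) :* (:1 :* :1)
       :+ X :* b :* (:1 :- q :* X) :* (:1 :- q :* (t :* t))) refl q X (pow q l) t)
    (drop-term _ _ qtt≈1)
  contiguous l X z zXb≈1 (suc k) = begin
    (1# - X * X * (q * b)) * ((q * K + b * t) * (poch (q * X) q (suc k) * poch z q (suc k)))
      ≈⟨ *-congˡ (*-congˡ (*-cong (poch-suc (q * X) q k) (poch-suc z q k))) ⟩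
    (1# - X * X * (q * b)) * ((q * K + b * t) * ((1# - q * X) * A * ((1# - z) * B)))
      ≈⟨ solve 8 (λ q X b t z K A B →
           (:1 :- X :* X :* (q :* b)) :* ((q :* K :+ b :* t) :* ((:1 :- q :* X) :* A :* ((:1 :- z) :* B)))
        := (:1 :- X :* b) :* (:1 :+ q :* X :* t :* b) :* ((:1 :- q :* X) :* A :* (B :* (:1 :- q :* z :* K)))
           :+ b :* t :* (:1 :- q :* X) :* (:1 :+ q :* X :* t) :* (A :* (:1 :- q :* (q :* X) :* K) :* ((:1 :- z) :* B))
           :+ A :* B :* (:1 :- q :* X) :* (:1 :- z) :* (X :* b) :* (:1 :- q :* X :* (q :* K)) :* (:1 :- q :* (t :* t))
           :+ (:- (A :* B :* (:1 :- q :* X) :* (:1 :- q :* K) :* (:1 :+ q :* (X :* b) :* t))) :* (:1 :- z :* (X :* b)))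
         refl q X b t z K A B ⟩
    rhs + e₁ * (1# - q * (t * t)) + e₂ * (1# - z * (X * b))
      ≈⟨ trans (drop-term _ _ zXb≈1) (drop-term _ _ qtt≈1) ⟩
    rhs
      ≈⟨ +-cong (*-congˡ (*-congʳ (poch-suc (q * X) q k))) (*-congˡ (*-congˡ (poch-suc z q k))) ⟨
    (1# - X * b) * (1# + q * X * t * b) * (poch (q * X) q (suc k) * poch (q * z) q (suc k))
      + b * t * (1# - q * X) * (1# + q * X * t) * (poch (q * (q * X)) q (suc k) * poch z q (suc k)) ∎
    where
    b = pow q l
    K = pow q k
    A = poch (q * (q * X)) q k
    B = poch (q * z) q k
    rhs = (1# - X * b) * (1# + q * X * t * b) * ((1# - q * X) * A * (B * (1# - q * z * K)))
        + b * t * (1# - q * X) * (1# + q * X * t) * (A * (1# - q * (q * X) * K) * ((1# - z) * B))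
    e₁ = A * B * (1# - q * X) * (1# - z) * (X * b) * (1# - q * X * (q * K))
    e₂ = - (A * B * (1# - q * X) * (1# - q * K) * (1# + q * (X * b) * t))

  -- For X = x/q and Y = q/x this is (x q^i, q^(2-i)/x; q)_k.
  Φ : Carrier → Carrier → ℕ → ℕ → Carrier
  Φ X Y i k = poch (pow q (suc i) * X) q k * poch (q * pow p i * Y) q k

  Φ-shift : ∀ X Y i k → Φ (q * X) (p * Y) i k ≈ Φ X Y (suc i) k
  Φ-shift X Y i k = *-cong
    (poch-congˡ q k (solve 3 (λ q X a → q :* a :* (q :* X) := q :* (q :* a) :* X) refl q X (pow q i)))
    (poch-congˡ q k (solve 4 (λ q p Y a → q :* a :* (p :* Y) := q :* (p :* a) :* Y) refl q p Y (pow p i)))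

  well-poised-expansion : ∀ l X Y → X * Y ≈ 1# → Admissible l X → ∀ k →
    P l (pow q k) * (poch (q * X) q k * poch (q * pow p l * Y) q k) ≈ sumTo l (λ i → D l i X * Φ X Y i k)
  well-poised-expansion zero X Y XY≈1 adm k = sym (*-cong D≈1 (*-congʳ (poch-congˡ q k (*-congʳ (*-identityʳ q)))))
    where
    D≈1 : D 0 0 X ≈ 1#
    D≈1 = trans
      (*-congʳ (solve 1 (λ X → :1 :* :1 :* :1 :* (:1 :- X :* X :* :1 :* :1) := :1 :* (:1 :- X :* X :* :1 :* :1)) refl X))
      (⁻¹-inverse _ (Admissible-poch 0 X adm 0 z≤n))
  -- The multiplier 1 - X² q^(l+1) of both three-term relations is cancelled last; its exponent lies
  -- in the admissible range. Only the new factor y + q^l t of `P (suc l) y` enters `contiguous`,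
  -- and the remaining `P l y` feeds the two instances at (X, Y) and (q X, p Y).
  well-poised-expansion (suc l) X Y XY≈1 adm k = *-cancelˡ (adm (suc l) (s≤s (ℕₚ.m≤m+n l (suc l)))) (begin
    c * (P l y * (y + b * t) * (poch (q * X) q k * poch z q k))
      ≈⟨ solve 4 (λ c p y f → c :* (p :* y :* f) := p :* (c :* (y :* f))) refl c (P l y) (y + b * t) _ ⟩
    P l y * (c * ((y + b * t) * (poch (q * X) q k * poch z q k)))
      ≈⟨ *-congˡ (contiguous l X z zXb≈1 k) ⟩
    P l y * (u * (poch (q * X) q k * poch (q * z) q k) + v * (poch (q * (q * X)) q k * poch z q k))
      ≈⟨ solve 5 (λ p u v f g → p :* (u :* f :+ v :* g) := u :* (p :* f) :+ v :* (p :* g)) refl (P l y) u v _ _ ⟩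
    u * (P l y * (poch (q * X) q k * poch (q * z) q k)) + v * (P l y * (poch (q * (q * X)) q k * poch z q k))
      ≈⟨ +-cong (*-congˡ (trans (*-congˡ (*-congˡ (poch-congˡ q k qz≈)))
                  (well-poised-expansion l X Y XY≈1 (Admissible-stay l X adm) k)))
                (*-congˡ (trans (*-congˡ (*-congˡ (poch-congˡ q k
                    (solve 4 (λ q p a Y → q :* (p :* a) :* Y := q :* a :* (p :* Y)) refl q p (pow p l) Y))))
                  (well-poised-expansion l (q * X) (p * Y) qXpY≈1 (Admissible-shift l X adm) k))) ⟩
    u * sumTo l (λ i → D l i X * Φ X Y i k) + v * sumTo l (λ i → D l i (q * X) * Φ (q * X) (p * Y) i k)
      ≈⟨ +-cong (*-distribˡ-sumTo l u _) (*-distribˡ-sumTo l v _) ⟩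
    sumTo l (λ i → u * (D l i X * Φ X Y i k)) + sumTo l (λ i → v * (D l i (q * X) * Φ (q * X) (p * Y) i k))
      ≈⟨ sumTo-pascal l
           (trans (sym (*-assoc _ _ _)) (trans (*-congʳ (D-pascal-zero l X adm)) (*-assoc _ _ _)))
           (λ i i≤l → trans (sym (*-assoc _ _ _)) (trans (*-congʳ (D-pascal-suc l i X i≤l adm))
             (trans (distribʳ _ _ _) (+-cong (*-assoc _ _ _) (trans (*-assoc _ _ _) (*-congˡ (*-congˡ (sym (Φ-shift X Y i k)))))))))
           (trans (*-congˡ (trans (*-congʳ (D-vanish l X)) (zeroˡ _))) (zeroʳ u)) ⟨
    sumTo (suc l) (λ i → c * (D (suc l) i X * Φ X Y i k))
      ≈⟨ *-distribˡ-sumTo (suc l) c _ ⟨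
    c * sumTo (suc l) (λ i → D (suc l) i X * Φ X Y i k) ∎)
    where
    b = pow q l
    y = pow q k
    z = q * pow p (suc l) * Y
    c = 1# - X * X * pow q (suc l)
    u = (1# - X * b) * (1# + q * X * t * b)
    v = b * t * (1# - q * X) * (1# + q * X * t)
    qXpY≈1 : q * X * (p * Y) ≈ 1#
    qXpY≈1 = trans (solve 4 (λ q X p Y → q :* X :* (p :* Y) := q :* p :* (X :* Y)) refl q X p Y)
      (trans (*-cong qp≈1 XY≈1) (*-identityˡ 1#))
    zXb≈1 : z * (X * b) ≈ 1#
    zXb≈1 = trans (solve 6 (λ q p a Y X b → q :* (p :* a) :* Y :* (X :* b) := q :* p :* (X :* Y) :* (b :* a)) refl q p (pow p l) Y X b)
      (trans (*-cong (trans (*-cong qp≈1 XY≈1) (*-identityˡ 1#)) (pow-inverse qp≈1 l)) (*-identityˡ 1#))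
    qz≈ : q * z ≈ q * pow p l * Y
    qz≈ = trans (solve 4 (λ q p a Y → q :* (q :* (p :* a) :* Y) := q :* p :* (q :* a :* Y)) refl q p (pow p l) Y)
      (trans (*-congʳ qp≈1) (*-identityˡ _))

-- Matching the coefficients with q-shifted factorials and exchanging the sums.

module Transformation {o ℓ} (F : CharZeroField o ℓ) (base : SquareRootBase F) where
  open CharZeroField F
  open SquareRootBase base
  open Basic F
  open FieldProperties F
  open CubicExpansion F base using (V; V-closed; newton-expansion)
  open WellPoisedExpansion F base
  open IntegerCoefficients commutativeRing
  open import Relation.Binary.Reasoning.Setoid setoid

  -- Both sides start at 1 and have the same ratio in i by `H-ratio`, because q^l (1 - q^(i-l)) =
  -- q^l - q^i. This recovers the sign, the power of q^(l-1/2) and (q^(-l); q)_i of the statement.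
  poch-H : ∀ l i → pow (- 1#) i * pow (pow q l * t) i * poch (pow p l) q i ≈ H l i * poch q q i
  poch-H l zero    = trans (solve 0 (:1 :* :1 :* :1 := :1 :* :1) refl) (*-congʳ (sym (H-zero l)))
  poch-H l (suc i) = begin
    - 1# * m * (b * t * n) * (c * (1# - b′ * a))
      ≈⟨ solve 7 (λ m n b t c b′ a → (:- :1) :* m :* (b :* t :* n) :* (c :* (:1 :- b′ :* a))
           := m :* n :* c :* (t :* ((b :* b′) :* a :- b))) refl m n b t c b′ a ⟩
    m * n * c * (t * (b * b′ * a - b))
      ≈⟨ *-cong (poch-H l i) (*-congˡ (+-congʳ (trans (*-congʳ (pow-inverse qp≈1 l)) (*-identityˡ a)))) ⟩
    H l i * poch q q i * (t * (a - b))
      ≈⟨ solve 4 (λ h c t d → h :* c :* (t :* d) := t :* d :* h :* c) refl (H l i) (poch q q i) t (a - b) ⟩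
    t * (a - b) * H l i * poch q q i
      ≈⟨ *-congʳ (H-ratio l i) ⟨
    (1# - q * a) * H l (suc i) * poch q q i
      ≈⟨ solve 3 (λ u h c → u :* h :* c := h :* (c :* u)) refl (1# - q * a) (H l (suc i)) (poch q q i) ⟩
    H l (suc i) * (poch q q i * (1# - q * a)) ∎
    where
    m  = pow (- 1#) i
    a  = pow q i
    b  = pow q l
    n  = pow (b * t) i
    b′ = pow p l
    c  = poch b′ q i

  -- Two ways of cutting (e; q)_{l+i+1}. At e = X² it exchanges the single run in `D` for the
  -- separate factors of the statement.
  poch-split : ∀ e l i → poch e q i * poch (e * pow q i) q (suc l)
    ≈ (1# - e) * poch (q * e) q l * poch (pow q (suc l) * e) q i
  poch-split e l i = begin
    poch e q i * poch (e * pow q i) q (suc l)                       ≈⟨ poch-+ e q i (suc l) ⟨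
    poch e q (i ℕ.+ suc l)                                          ≡⟨ ≡.cong (poch e q) (ℕₚ.+-comm i (suc l)) ⟩
    poch e q (suc l ℕ.+ i)                                          ≈⟨ poch-+ e q (suc l) i ⟩
    poch e q (suc l) * poch (e * pow q (suc l)) q i                 ≈⟨ *-cong (poch-suc e q l) (poch-congˡ q i (*-comm _ _)) ⟩
    (1# - e) * poch (q * e) q l * poch (pow q (suc l) * e) q i      ∎

  prefactor : ℕ → Carrier → Carrier
  prefactor l X = (poch X q l * poch (- (q * X * t)) q l) * ((poch (q * (X * X)) q l * poch (- t) q l) ⁻¹)

  coefficient : ℕ → ℕ → Carrier → Carrier
  coefficient l i X =
      pow (- 1#) i
    * pow (pow q l * t) i
    * (1# - X * X * pow q i * pow q i)
    * ((1# - X * X) ⁻¹)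
    * (poch (pow p l) q i * poch (q * X) q i * poch (X * X) q i)
    * ((poch q q i * poch X q i * poch (pow q (suc l) * (X * X)) q i) ⁻¹)

  D-closed : ∀ l i X → i ≤ l → Admissible l X →
    ¬ (poch (q * (X * X)) q l * poch (- t) q l ≈ 0#) → ¬ (1# - X * X ≈ 0#) →
    ¬ (poch q q i * poch X q i * poch (pow q (suc l) * (X * X)) q i ≈ 0#) →
    poch (- t) q l * (prefactor l X * coefficient l i X) ≈ D l i X
  D-closed l i X i≤l adm d₁≉0 d₂≉0 d₃≉0 = begin
    τ * (x₁ * r * d₁ ⁻¹ * (m * n * e * d₂ ⁻¹ * (c₁ * x₂ * w) * d₃ ⁻¹))
      ≈⟨ solve 12 (λ τ x₁ r i₁ m n e i₂ c₁ x₂ w i₃ →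
           τ :* (x₁ :* r :* i₁ :* (m :* n :* e :* i₂ :* (c₁ :* x₂ :* w) :* i₃))
        := τ :* r :* e :* (x₁ :* x₂) :* (m :* n :* c₁) :* w :* (i₁ :* i₂ :* i₃)) refl
         τ x₁ r (d₁ ⁻¹) m n e (d₂ ⁻¹) c₁ x₂ w (d₃ ⁻¹) ⟩
    τ * r * e * (x₁ * x₂) * (m * n * c₁) * w * (d₁ ⁻¹ * d₂ ⁻¹ * d₃ ⁻¹)
      ≈⟨ *-congʳ (*-congʳ (*-cong (*-congˡ (g-closed l i X i≤l)) (poch-H l i))) ⟩
    τ * r * e * (g l i X * y₁) * (H l i * y₂) * w * (d₁ ⁻¹ * d₂ ⁻¹ * d₃ ⁻¹)
      -- Clearing `d₄` turns `w * d₄` into `d₂ * x₃ * y₃` by `poch-split`, after which each of the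
      -- three inverses meets its own denominator.
      ≈⟨ *-cancelˡ d₄≉0 (begin
           d₄ * (τ * r * e * (g l i X * y₁) * (H l i * y₂) * w * (d₁ ⁻¹ * d₂ ⁻¹ * d₃ ⁻¹))
             ≈⟨ solve 12 (λ d₄ τ r e g y₁ h y₂ w i₁ i₂ i₃ →
                  d₄ :* (τ :* r :* e :* (g :* y₁) :* (h :* y₂) :* w :* (i₁ :* i₂ :* i₃))
               := h :* g :* r :* e :* (τ :* y₁ :* y₂ :* (w :* d₄) :* (i₁ :* i₂ :* i₃))) refl
                d₄ τ r e (g l i X) y₁ (H l i) y₂ w (d₁ ⁻¹) (d₂ ⁻¹) (d₃ ⁻¹) ⟩
           H l i * g l i X * r * e * (τ * y₁ * y₂ * (w * d₄) * (d₁ ⁻¹ * d₂ ⁻¹ * d₃ ⁻¹))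
             ≈⟨ *-congˡ (*-congʳ (*-congˡ (poch-split (X * X) l i))) ⟩
           H l i * g l i X * r * e * (τ * y₁ * y₂ * (d₂ * x₃ * y₃) * (d₁ ⁻¹ * d₂ ⁻¹ * d₃ ⁻¹))
             ≈⟨ *-congˡ (solve 9 (λ τ y₁ y₂ d₂ x₃ y₃ i₁ i₂ i₃ →
                  τ :* y₁ :* y₂ :* (d₂ :* x₃ :* y₃) :* (i₁ :* i₂ :* i₃)
               := x₃ :* τ :* i₁ :* (d₂ :* i₂) :* (y₂ :* y₁ :* y₃ :* i₃)) refl τ y₁ y₂ d₂ x₃ y₃ (d₁ ⁻¹) (d₂ ⁻¹) (d₃ ⁻¹)) ⟩
           H l i * g l i X * r * e * (d₁ * d₁ ⁻¹ * (d₂ * d₂ ⁻¹) * (d₃ * d₃ ⁻¹))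
             ≈⟨ *-congˡ (*-cong (*-cong (⁻¹-inverse d₁ d₁≉0) (⁻¹-inverse d₂ d₂≉0)) (⁻¹-inverse d₃ d₃≉0)) ⟩
           H l i * g l i X * r * e * (1# * 1# * 1#)
             ≈⟨ *-congˡ (trans (*-congʳ (*-identityˡ 1#)) (*-congˡ (sym (⁻¹-inverse d₄ d₄≉0)))) ⟩
           H l i * g l i X * r * e * (1# * (d₄ * d₄ ⁻¹))
             ≈⟨ solve 3 (λ h d i → h :* (:1 :* (d :* i)) := d :* (h :* i)) refl _ d₄ (d₄ ⁻¹) ⟩
           d₄ * D l i X ∎) ⟩
    D l i X ∎
    where
    τ  = poch (- t) q l
    x₁ = poch X q l
    x₂ = poch (q * X) q i
    x₃ = poch (q * (X * X)) q l
    r  = poch (- (q * X * t)) q l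
    m  = pow (- 1#) i
    n  = pow (pow q l * t) i
    e  = 1# - X * X * pow q i * pow q i
    c₁ = poch (pow p l) q i
    w  = poch (X * X) q i
    y₁ = poch X q i
    y₂ = poch q q i
    y₃ = poch (pow q (suc l) * (X * X)) q i
    d₁ = x₃ * τ
    d₂ = 1# - X * X
    d₃ = y₂ * y₁ * y₃
    d₄ = poch (X * X * pow q i) q (suc l)
    d₄≉0 : ¬ (d₄ ≈ 0#)
    d₄≉0 = Admissible-poch l X adm i i≤l

  -- The exponents 0, ..., 2l are covered in three pieces: 0 by 1 - X², 1 to l by (q X²; q)_l, and l
  -- + 1 to 2l by (q^(l+1) X²; q)_l.
  admissible : ∀ l X → ¬ (1# - X * X ≈ 0#) → ¬ (poch (q * (X * X)) q l ≈ 0#) →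
    ¬ (poch (pow q (suc l) * (X * X)) q l ≈ 0#) → Admissible l X
  admissible l X h₀ h₁ h₂ zero    _  = nonzero-resp (+-congˡ (-‿cong (sym (*-identityʳ _)))) h₀
  admissible l X h₀ h₁ h₂ (suc j) 1+j≤2l with j ℕₚ.<? l
  ... | yes j<l = nonzero-resp
        (solve 3 (λ q X a → :1 :- q :* (X :* X) :* a := :1 :- X :* X :* (q :* a)) refl q X (pow q j))
        (poch-factor-nonzero _ q l h₁ j j<l)
  ... | no  j≮l = nonzero-resp
        (+-congˡ (-‿cong (begin
          q * pow q l * (X * X) * pow q (j ℕ.∸ l)     ≈⟨ solve 4 (λ q a X b → q :* a :* (X :* X) :* b := X :* X :* (q :* (a :* b))) refl q (pow q l) X _ ⟩
          X * X * (q * (pow q l * pow q (j ℕ.∸ l)))   ≈⟨ *-congˡ (*-congˡ (pow-+ q l (j ℕ.∸ l))) ⟨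
          X * X * (q * pow q (l ℕ.+ (j ℕ.∸ l)))       ≡⟨ ≡.cong (λ i → X * X * (q * pow q i)) (ℕₚ.m+[n∸m]≡n l≤j) ⟩
          X * X * (q * pow q j)                       ∎)))
        (poch-factor-nonzero _ q l h₂ (j ℕ.∸ l)
          (ℕₚ.+-cancelˡ-< l _ _ (≡.subst (_< l ℕ.+ l) (≡.sym (ℕₚ.m+[n∸m]≡n l≤j)) 1+j≤2l)))
    where
    l≤j : l ≤ j
    l≤j = ℕₚ.≮⇒≥ j≮l

  module _ (X Y : Carrier) (XY≈1 : X * Y ≈ 1#) (l n : ℕ) where

    τ ε N : Carrier
    τ = poch (- t) q l
    ε = pow (pow p 3) n
    N = poch (q * q) (pow q 3) n * poch (pow q 4) (pow q 3) n

    denominator : ℕ → Carrier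
    denominator k = poch q q k * poch (- q) q k * poch (q * q * t) q k
                  * poch (- (q * q * t * pow p l)) q k * poch (p * ε) q k

    summand : ℕ → Carrier
    summand k = poch ε (pow q 3) k * (poch (q * X) q k * poch (q * pow p l * Y) q k) * denominator k ⁻¹ * pow q k

    cubic : ℕ → Carrier
    cubic i = poch (q * q * (pow q (suc i) * X)) (pow q 3) n * poch (pow q 4 * (pow p (suc i) * Y)) (pow q 3) n

    -- The constant `N` is the one `V-closed` calls for and `τ` the one `poch-P` calls for. Between
    -- these two uses the product `a₄`, that is (-q^(3/2); q)_k, occurs only as a factor and is
    -- never inverted.
    summand-closed : ∀ k → ¬ (denominator k ≈ 0#) →
      N * τ * summand k ≈ V n k * (P l (pow q k) * (poch (q * X) q k * poch (q * pow p l * Y) q k))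
    summand-closed k den≉0 = begin
      N * τ * (d * f * denominator k ⁻¹ * K)
        ≈⟨ solve 6 (λ N τ d f i K → N :* τ :* (d :* f :* i :* K) := N :* d :* K :* (τ :* f :* i)) refl N τ d f (denominator k ⁻¹) K ⟩
      N * d * K * (τ * f * denominator k ⁻¹)
        ≈⟨ *-congʳ (V-closed n k) ⟨
      V n k * (a₁ * a₂ * a₃ * a₄ * a₅) * (τ * f * denominator k ⁻¹)
        ≈⟨ solve 9 (λ v a₁ a₂ a₃ a₄ a₅ τ f i → v :* (a₁ :* a₂ :* a₃ :* a₄ :* a₅) :* (τ :* f :* i)
             := v :* (a₁ :* a₂ :* a₃ :* (a₄ :* τ) :* a₅ :* f :* i)) refl (V n k) a₁ a₂ a₃ a₄ a₅ τ f (denominator k ⁻¹) ⟩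
      V n k * (a₁ * a₂ * a₃ * (a₄ * τ) * a₅ * f * denominator k ⁻¹)
        ≈⟨ *-congˡ (*-congʳ (*-congʳ (*-congʳ (*-congˡ (poch-P l k))))) ⟩
      V n k * (a₁ * a₂ * a₃ * (a₄′ * P l K) * a₅ * f * denominator k ⁻¹)
        ≈⟨ *-congˡ (solve 8 (λ a₁ a₂ a₃ a₄ P a₅ f i → a₁ :* a₂ :* a₃ :* (a₄ :* P) :* a₅ :* f :* i
             := a₁ :* a₂ :* a₃ :* a₄ :* a₅ :* i :* (P :* f)) refl a₁ a₂ a₃ a₄′ (P l K) a₅ f (denominator k ⁻¹)) ⟩
      V n k * (denominator k * denominator k ⁻¹ * (P l K * f))
        ≈⟨ *-congˡ (trans (*-congʳ (⁻¹-inverse _ den≉0)) (*-identityˡ _)) ⟩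
      V n k * (P l K * f) ∎
      where
      K  = pow q k
      a₁ = poch q q k
      a₂ = poch (- q) q k
      a₃ = poch (q * q * t) q k
      a₄ = poch (- (q * q * t)) q k
      a₄′ = poch (- (q * q * t * pow p l)) q k
      a₅ = poch (p * ε) q k
      d  = poch ε (pow q 3) k
      f  = poch (q * X) q k * poch (q * pow p l * Y) q k

    cubic-expansion : ∀ i → cubic i ≈ sumTo n (λ k → V n k * Φ X Y i k)
    cubic-expansion i = trans
      (newton-expansion (pow q (suc i) * X) (pow p (suc i) * Y) uv≈1 n)
      (sumTo-cong n (λ k _ → *-congˡ (*-congˡ (poch-congˡ q k (begin
        q * q * (p * pow p i * Y)    ≈⟨ solve 4 (λ q p a Y → q :* q :* (p :* a :* Y) := q :* p :* (q :* a :* Y)) refl q p (pow p i) Y ⟩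
        q * p * (q * pow p i * Y)    ≈⟨ trans (*-congʳ qp≈1) (*-identityˡ _) ⟩
        q * pow p i * Y              ∎)))))
      where
      uv≈1 : pow q (suc i) * X * (pow p (suc i) * Y) ≈ 1#
      uv≈1 = trans (solve 4 (λ a X b Y → a :* X :* (b :* Y) := a :* b :* (X :* Y)) refl (pow q (suc i)) X (pow p (suc i)) Y)
        (trans (*-cong (pow-inverse qp≈1 (suc i)) XY≈1) (*-identityˡ 1#))

    transformation :
      (∀ k → k ≤ n → ¬ (denominator k ≈ 0#)) →
      ¬ (poch (q * (X * X)) q l ≈ 0#) → ¬ (τ ≈ 0#) → ¬ (1# - X * X ≈ 0#) →
      (∀ i → i ≤ l → ¬ (poch q q i ≈ 0#)) →
      (∀ i → i ≤ l → ¬ (poch X q i ≈ 0#)) →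
      (∀ i → i ≤ l → ¬ (poch (pow q (suc l) * (X * X)) q i ≈ 0#)) →
      ¬ (N ≈ 0#) →
      sumTo n summand ≈ prefactor l X * sumTo l (λ i → coefficient l i X * cubic i * N ⁻¹)
    transformation den≉0 x₃≉0 τ≉0 d₂≉0 y₁≉0 y₂≉0 y₃≉0 N≉0 = *-cancelˡ (*-nonzero N≉0 τ≉0) (begin
      N * τ * sumTo n summand
        ≈⟨ *-distribˡ-sumTo n _ _ ⟩
      sumTo n (λ k → N * τ * summand k)
        ≈⟨ sumTo-cong n (λ k k≤n → trans (summand-closed k (den≉0 k k≤n))
             (*-congˡ (well-poised-expansion l X Y XY≈1 adm k))) ⟩
      sumTo n (λ k → V n k * sumTo l (λ i → D l i X * Φ X Y i k))
        ≈⟨ sumTo-cong n (λ k _ → trans (*-distribˡ-sumTo l _ _) (sumTo-cong l (λ i _ →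
             solve 3 (λ v d f → v :* (d :* f) := d :* (v :* f)) refl (V n k) (D l i X) (Φ X Y i k)))) ⟩
      sumTo n (λ k → sumTo l (λ i → D l i X * (V n k * Φ X Y i k)))
        ≈⟨ sumTo-swap n l _ ⟩
      sumTo l (λ i → sumTo n (λ k → D l i X * (V n k * Φ X Y i k)))
        ≈⟨ sumTo-cong l (λ i _ → trans (*-congˡ (cubic-expansion i)) (*-distribˡ-sumTo n _ _)) ⟨
      sumTo l (λ i → D l i X * cubic i)
        ≈⟨ sumTo-cong l (λ i i≤l → term i i≤l) ⟨
      sumTo l (λ i → N * τ * prefactor l X * (coefficient l i X * cubic i * N ⁻¹))
        ≈⟨ *-distribˡ-sumTo l _ _ ⟨
      N * τ * prefactor l X * sumTo l (λ i → coefficient l i X * cubic i * N ⁻¹)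
        ≈⟨ *-assoc _ _ _ ⟩
      N * τ * (prefactor l X * sumTo l (λ i → coefficient l i X * cubic i * N ⁻¹)) ∎)
      where
      adm : Admissible l X
      -- The denominator of the last term, i = l, supplies the upper half of the exponents.
      adm = admissible l X d₂≉0 x₃≉0 (y₃≉0 l ℕₚ.≤-refl)
      term : ∀ i → i ≤ l → N * τ * prefactor l X * (coefficient l i X * cubic i * N ⁻¹) ≈ D l i X * cubic i
      term i i≤l = begin
        N * τ * prefactor l X * (coefficient l i X * cubic i * N ⁻¹)
          ≈⟨ solve 6 (λ N τ C c f j → N :* τ :* C :* (c :* f :* j) := N :* j :* (τ :* (C :* c) :* f)) refl
               N τ (prefactor l X) (coefficient l i X) (cubic i) (N ⁻¹) ⟩
        N * N ⁻¹ * (τ * (prefactor l X * coefficient l i X) * cubic i)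
          ≈⟨ trans (*-congʳ (⁻¹-inverse N N≉0)) (*-identityˡ _) ⟩
        τ * (prefactor l X * coefficient l i X) * cubic i
          ≈⟨ *-congʳ (D-closed l i X i≤l adm (*-nonzero x₃≉0 τ≉0) d₂≉0
               (*-nonzero (*-nonzero (y₁≉0 i i≤l) (y₂≉0 i i≤l)) (y₃≉0 i i≤l))) ⟩
        D l i X * cubic i ∎

-- Integer powers of the square root of q.

module IntegerPowers {o ℓ} (F : CharZeroField o ℓ)
  (s : CharZeroField.Carrier F) (s≉0 : ¬ (CharZeroField._≈_ F s (CharZeroField.0# F))) where
  open CharZeroField F
  open Basic F
  open FieldProperties F
  open import Relation.Binary.Reasoning.Setoid setoid
  open IntegerCoefficients commutativeRing using (solve; _:=_; _:*_)

  zpow-⊖ : ∀ m n → zpow s (m ⊖ n) ≈ pow s m * pow (s ⁻¹) n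
  zpow-⊖ m       zero    = sym (*-identityʳ _)
  zpow-⊖ zero    (suc n) = sym (*-identityˡ _)
  zpow-⊖ (suc m) (suc n) = begin
    zpow s (suc m ⊖ suc n)                        ≡⟨ ≡.cong (zpow s) (ℤₚ.[1+m]⊖[1+n]≡m⊖n m n) ⟩
    zpow s (m ⊖ n)                                ≈⟨ zpow-⊖ m n ⟩
    pow s m * pow (s ⁻¹) n                        ≈⟨ trans (*-congʳ (⁻¹-inverse s s≉0)) (*-identityˡ _) ⟨
    s * s ⁻¹ * (pow s m * pow (s ⁻¹) n)           ≈⟨ solve 4 (λ a b c d → a :* b :* (c :* d) := a :* c :* (b :* d)) refl _ _ _ _ ⟩
    s * pow s m * (s ⁻¹ * pow (s ⁻¹) n)           ∎

  zpow-+ : ∀ i j → zpow s (i +ℤ j) ≈ zpow s i * zpow s j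
  zpow-+ (+ m)    (+ n)    = pow-+ s m n
  zpow-+ (+ m)    -[1+ n ] = zpow-⊖ m (suc n)
  zpow-+ -[1+ m ] (+ n)    = trans (zpow-⊖ n (suc m)) (*-comm _ _)
  zpow-+ -[1+ m ] -[1+ n ] = trans
    (reflexive (≡.cong (λ k → pow (s ⁻¹) (suc k)) (≡.sym (ℕₚ.+-suc m n)))) (pow-+ (s ⁻¹) (suc m) (suc n))

  zpow-neg : ∀ n → zpow s (-ℤ (+ n)) ≈ pow (s ⁻¹) n
  zpow-neg zero    = refl
  zpow-neg (suc n) = refl

  zpow-scaled : ∀ k n → zpow s (+ k *ℤ + n) ≈ pow (pow s k) n
  zpow-scaled k n = trans (reflexive (≡.cong (zpow s) (≡.sym (ℤₚ.pos-* k n)))) (pow-pow s k n)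

  zpow-neg-scaled : ∀ k n → zpow s (-ℤ (+ k *ℤ + n)) ≈ pow (pow (s ⁻¹) k) n
  zpow-neg-scaled k n = trans (reflexive (≡.cong (λ i → zpow s (-ℤ i)) (≡.sym (ℤₚ.pos-* k n))))
    (trans (zpow-neg (k ℕ.* n)) (pow-pow (s ⁻¹) k n))

  zpow-+-scaled : ∀ i k n → zpow s (i +ℤ + k *ℤ + n) ≈ zpow s i * pow (pow s k) n
  zpow-+-scaled i k n = trans (zpow-+ i (+ k *ℤ + n)) (*-congˡ (zpow-scaled k n))

  zpow-sub-scaled : ∀ i k n → zpow s (i -ℤ + k *ℤ + n) ≈ zpow s i * pow (pow (s ⁻¹) k) n
  zpow-sub-scaled i k n = trans (zpow-+ i (-ℤ (+ k *ℤ + n))) (*-congˡ (zpow-neg-scaled k n))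

  zpow-scaled-sub : ∀ k n m → zpow s (+ k *ℤ + n -ℤ + m) ≈ pow (pow s k) n * pow (s ⁻¹) m
  zpow-scaled-sub k n m = trans (zpow-+ (+ k *ℤ + n) (-ℤ (+ m))) (*-cong (zpow-scaled k n) (zpow-neg m))

  -- Meant for the exponent (2l - 1) i, whose first factor is -1 at l = 0 and so cannot be treated
  -- as a natural number.
  zpow-*-+ : ∀ i n → zpow s (i *ℤ + n) ≈ pow (zpow s i) n
  zpow-*-+ i zero    = reflexive (≡.cong (zpow s) (ℤₚ.*-zeroʳ i))
  zpow-*-+ i (suc n) = trans (reflexive (≡.cong (zpow s) (ℤₚ.*-suc i (+ n))))
    (trans (zpow-+ i (i *ℤ + n)) (*-congˡ (zpow-*-+ i n)))

-- The identity in half-integer powers of q, with s = q^(1/2).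

theorem5 : ∀ {c ℓ′ : Level} (F : CharZeroField c ℓ′) →
    let open CharZeroField F in
    let open Basic F in
    (s x : Carrier) (l n : ℕ) →
    let q  = pow s 2 in
    let q3 = pow s 6 in
    let Q  = zpow s in
    ¬ (s ≈ 0#) →
    ¬ (x ≈ 0#) →
    (∀ k → k ≤ n → ¬ (poch q q k ≈ 0#)) →
    (∀ k → k ≤ n → ¬ (poch (- q) q k ≈ 0#)) →
    (∀ k → k ≤ n → ¬ (poch (Q (+ 3)) q k ≈ 0#)) →
    (∀ k → k ≤ n → ¬ (poch (- Q (+ 3 -ℤ + 2 *ℤ + l)) q k ≈ 0#)) →
    (∀ k → k ≤ n → ¬ (poch (Q (-ℤ (+ 2) -ℤ + 6 *ℤ + n)) q k ≈ 0#)) →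
    ¬ (poch (x * x * Q (-ℤ (+ 2))) q l ≈ 0#) →
    ¬ (poch (- Q (-ℤ (+ 1))) q l ≈ 0#) →
    ¬ ((1# - x * x * Q (-ℤ (+ 4))) ≈ 0#) →
    (∀ i → i ≤ l → ¬ (poch q q i ≈ 0#)) →
    (∀ i → i ≤ l → ¬ (poch (x * Q (-ℤ (+ 2))) q i ≈ 0#)) →
    (∀ i → i ≤ l → ¬ (poch (x * x * Q (+ 2 *ℤ + l -ℤ + 2)) q i ≈ 0#)) →
    ¬ (poch (Q (+ 4)) q3 n ≈ 0#) →
    ¬ (poch (Q (+ 8)) q3 n ≈ 0#) →
    sumTo n (λ k →
    poch (Q (-ℤ (+ 6 *ℤ + n))) q3 k
    * (poch x q k * poch (Q (+ 4 -ℤ + 2 *ℤ + l) * (x ⁻¹)) q k)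
    * (( poch q q k * poch (- q) q k * poch (Q (+ 3)) q k
    * poch (- Q (+ 3 -ℤ + 2 *ℤ + l)) q k
    * poch (Q (-ℤ (+ 2) -ℤ + 6 *ℤ + n)) q k) ⁻¹)
    * pow q k)
    ≈
    (poch (x * Q (-ℤ (+ 2))) q l * poch (- (x * Q (-ℤ (+ 1)))) q l)
    * ((poch (x * x * Q (-ℤ (+ 2))) q l * poch (- Q (-ℤ (+ 1))) q l) ⁻¹)
    * sumTo l (λ i →
    pow (- 1#) i
    * Q ((+ 2 *ℤ + l -ℤ + 1) *ℤ + i)
    * (1# - x * x * Q (+ 4 *ℤ + i -ℤ + 4))
    * ((1# - x * x * Q (-ℤ (+ 4))) ⁻¹)
    * (poch (Q (-ℤ (+ 2 *ℤ + l))) q i * poch x q i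
    * poch (x * x * Q (-ℤ (+ 4))) q i)
    * ((poch q q i * poch (x * Q (-ℤ (+ 2))) q i
    * poch (x * x * Q (+ 2 *ℤ + l -ℤ + 2)) q i) ⁻¹)
    * (poch (Q (+ 4 +ℤ + 2 *ℤ + i) * x) q3 n
    * poch (Q (+ 8 -ℤ + 2 *ℤ + i) * (x ⁻¹)) q3 n)
    * ((poch (Q (+ 4)) q3 n * poch (Q (+ 8)) q3 n) ⁻¹))
theorem5 F s x l n s≉0 x≉0 a₁≉0 a₂≉0 a₃≉0 a₄≉0 a₅≉0 x₃≉0 τ≉0 d₂≉0 y₁≉0 y₂≉0 y₃≉0 N₁≉0 N₂≉0 = begin
  _ ≈⟨ sumTo-cong n (λ k _ → *-congʳ (*-cong
         (*-cong (poch-cong ε≈ q3≈ k) (*-cong (poch-congˡ q k x≈) (poch-congˡ q k w≈)))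
         (⁻¹-cong (denominator≈ k)))) ⟩
  sumTo n (summand X Y XY≈1 l n)
    ≈⟨ transformation X Y XY≈1 l n
         (λ k k≤n → nonzero-resp (denominator≈ k) (*-nonzero (*-nonzero (*-nonzero (*-nonzero
           (a₁≉0 k k≤n) (a₂≉0 k k≤n)) (a₃≉0 k k≤n)) (a₄≉0 k k≤n)) (a₅≉0 k k≤n)))
         (nonzero-resp (poch-congˡ q l qXX≈) x₃≉0) (nonzero-resp (poch-congˡ q l -t≈) τ≉0) (nonzero-resp d₂≈ d₂≉0)
         y₁≉0 y₂≉0 (λ i i≤l → nonzero-resp (poch-congˡ q i y₃≈) (y₃≉0 i i≤l))
         (nonzero-resp N≈ (*-nonzero N₁≉0 N₂≉0)) ⟩
  prefactor l X * sumTo l (λ i → coefficient l i X * cubic X Y XY≈1 l n i * N X Y XY≈1 l n ⁻¹)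
    ≈⟨ *-cong
         (*-cong (*-congˡ (poch-congˡ q l -qXt≈)) (⁻¹-cong (*-cong (poch-congˡ q l qXX≈) (poch-congˡ q l -t≈))))
         (sumTo-cong l (λ i _ → *-cong
           (*-cong
             (*-cong
               (*-cong
                 (*-cong (*-cong (*-congˡ (trans (zpow-*-+ (+ 2 *ℤ + l -ℤ + 1) i) (pow-cong bt≈ i))) (+-congˡ (-‿cong (e≈ i)))) (⁻¹-cong d₂≈))
                 (*-cong (*-cong (poch-congˡ q i (zpow-neg-scaled 2 l)) (poch-congˡ q i x≈)) (poch-congˡ q i XX≈)))
               (⁻¹-cong (*-congˡ (poch-congˡ q i y₃≈))))
             (*-cong (poch-cong (u≈ i) q3≈ n) (poch-cong (v≈ i) q3≈ n)))
           (⁻¹-cong N≈))) ⟨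
  _ ∎
  where
  open CharZeroField F
  open Basic F
  open FieldProperties F
  open IntegerPowers F s s≉0
  open IntegerCoefficients commutativeRing
  open import Relation.Binary.Reasoning.Setoid setoid
  q t p X Y : Carrier
  q = pow s 2
  t = s ⁻¹
  p = pow t 2
  X = x * p
  Y = q * x ⁻¹
  st≈1 : s * t ≈ 1#
  st≈1 = ⁻¹-inverse s s≉0
  qp≈1 : q * p ≈ 1#
  qp≈1 = pow-inverse st≈1 2
  qtt≈1 : q * (t * t) ≈ 1#
  qtt≈1 = trans (*-congˡ (*-congˡ (sym (*-identityʳ t)))) qp≈1
  base : SquareRootBase F
  base = record { q = q ; p = p ; t = t ; qp≈1 = qp≈1 ; qtt≈1 = qtt≈1 }
  open Transformation F base
  -- Multiplying one side by q p or s t equalizes the numbers of q, p, s and t on both sides, so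
  -- that the solver can compare them as monomials.
  absorb : ∀ {u} → u ≈ 1# → ∀ a → a ≈ u * a
  absorb u≈1 a = sym (trans (*-congʳ u≈1) (*-identityˡ a))
  XY≈1 : X * Y ≈ 1#
  XY≈1 = trans (solve 4 (λ x p q y → x :* p :* (q :* y) := q :* p :* (x :* y)) refl x p q (x ⁻¹))
    (trans (*-cong qp≈1 (⁻¹-inverse x x≉0)) (*-identityˡ 1#))
  x≈ : x ≈ q * X
  x≈ = trans (absorb qp≈1 x) (solve 3 (λ q p x → q :* p :* x := q :* (x :* p)) refl q p x)
  w≈ : zpow s (+ 4 -ℤ + 2 *ℤ + l) * x ⁻¹ ≈ q * pow p l * Y
  w≈ = trans (*-congʳ (zpow-sub-scaled (+ 4) 2 l))
    (solve 3 (λ s a y → s :^ 4 :* a :* y := s :^ 2 :* a :* (s :^ 2 :* y)) refl s (pow p l) (x ⁻¹))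
  q3≈ : pow s 6 ≈ pow q 3
  q3≈ = pow-pow s 2 3
  ε≈ : zpow s (-ℤ (+ 6 *ℤ + n)) ≈ pow (pow p 3) n
  ε≈ = trans (zpow-neg-scaled 6 n) (pow-cong (pow-pow t 2 3) n)
  s³≈ : zpow s (+ 3) ≈ q * q * t
  s³≈ = trans (absorb st≈1 _) (solve 2 (λ s t → s :* t :* s :^ 3 := s :^ 2 :* s :^ 2 :* t) refl s t)
  denominator≈ : ∀ k →
    poch q q k * poch (- q) q k * poch (zpow s (+ 3)) q k
      * poch (- zpow s (+ 3 -ℤ + 2 *ℤ + l)) q k * poch (zpow s (-ℤ (+ 2) -ℤ + 6 *ℤ + n)) q k
    ≈ denominator X Y XY≈1 l n k
  denominator≈ k = *-cong (*-cong (*-congˡ (poch-congˡ q k s³≈))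
      (poch-congˡ q k (-‿cong (trans (zpow-sub-scaled (+ 3) 2 l) (*-congʳ s³≈)))))
    (poch-congˡ q k (trans (zpow-sub-scaled (-ℤ (+ 2)) 6 n) (*-congˡ (pow-cong (pow-pow t 2 3) n))))
  -qXt≈ : - (x * zpow s (-ℤ (+ 1))) ≈ - (q * X * t)
  -qXt≈ = -‿cong (*-cong x≈ (*-identityʳ t))
  qXX≈ : x * x * zpow s (-ℤ (+ 2)) ≈ q * (X * X)
  qXX≈ = trans (absorb qp≈1 _) (solve 3 (λ q p x → q :* p :* (x :* x :* p) := q :* (x :* p :* (x :* p))) refl q p x)
  -t≈ : - zpow s (-ℤ (+ 1)) ≈ - t
  -t≈ = -‿cong (*-identityʳ t)
  XX≈ : x * x * zpow s (-ℤ (+ 4)) ≈ X * X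
  XX≈ = solve 2 (λ x t → x :* x :* t :^ 4 := x :* t :^ 2 :* (x :* t :^ 2)) refl x t
  d₂≈ : 1# - x * x * zpow s (-ℤ (+ 4)) ≈ 1# - X * X
  d₂≈ = +-congˡ (-‿cong XX≈)
  y₃≈ : x * x * zpow s (+ 2 *ℤ + l -ℤ + 2) ≈ pow q (suc l) * (X * X)
  y₃≈ = trans (*-congˡ (zpow-scaled-sub 2 l 2)) (trans (absorb qp≈1 _)
    (solve 4 (λ q p x b → q :* p :* (x :* x :* (b :* p)) := q :* b :* (x :* p :* (x :* p))) refl q p x (pow q l)))
  N≈ : poch (zpow s (+ 4)) (pow s 6) n * poch (zpow s (+ 8)) (pow s 6) n ≈ N X Y XY≈1 l n
  N≈ = *-cong
    (poch-cong (solve 1 (λ s → s :^ 4 := s :^ 2 :* s :^ 2) refl s) q3≈ n)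
    (poch-cong (pow-pow s 2 4) q3≈ n)
  bt≈ : zpow s (+ 2 *ℤ + l -ℤ + 1) ≈ pow q l * t
  bt≈ = trans (zpow-scaled-sub 2 l 1) (*-congˡ (*-identityʳ t))
  e≈ : ∀ i → x * x * zpow s (+ 4 *ℤ + i -ℤ + 4) ≈ X * X * pow q i * pow q i
  e≈ i = trans (*-congˡ (trans (zpow-scaled-sub 4 i 4) (*-congʳ (trans (pow-cong (pow-+ s 2 2) i) (pow-* q q i)))))
    (solve 3 (λ x t a → x :* x :* (a :* a :* t :^ 4) := x :* t :^ 2 :* (x :* t :^ 2) :* a :* a) refl x t (pow q i))
  u≈ : ∀ i → zpow s (+ 4 +ℤ + 2 *ℤ + i) * x ≈ q * q * (pow q (suc i) * X)
  u≈ i = trans (*-cong (zpow-+-scaled (+ 4) 2 i) x≈)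
    (solve 3 (λ s a X → s :^ 4 :* a :* (s :^ 2 :* X) := s :^ 2 :* s :^ 2 :* (s :^ 2 :* a :* X)) refl s (pow q i) X)
  v≈ : ∀ i → zpow s (+ 8 -ℤ + 2 *ℤ + i) * x ⁻¹ ≈ pow q 4 * (pow p (suc i) * Y)
  v≈ i = trans (*-congʳ (zpow-sub-scaled (+ 8) 2 i)) (trans (absorb qp≈1 _)
    (solve 4 (λ s p a y → s :^ 2 :* p :* (s :^ 8 :* a :* y) := (s :^ 2) :^ 4 :* (p :* a :* (s :^ 2 :* y))) refl s p (pow p i) (x ⁻¹)))
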